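{- Let $\Gamma = \mathcal{N}(2m;1,b,b+m+1;m-1)$, where $b = 4b_0-1$ for some integer $b_0 > 1$ and $m > 2$ is an even divisor of $b^2+3$ with $m \equiv 2 \pmod{4}$ and $b < 2m$. Then $\Gamma$ is a half-arc-transitive graph. Moreover, its reachability relation is universal if and only if $3$ does not divide $m$, while in the case that $3$ divides $m$ the graph $\Gamma$ has exactly three alternets.
   Context: For integers $n \geq 4$ and $1 \leq a,b,c,k \leq n-1$ with $k \neq n/2$ and $a,b,c$ pairwise distinct, the Nest graph $\mathcal{N}(n;a,b,c;k)$ is the graph with vertex set $\{u_i : i \in \mathbb{Z}_n\} \cup \{v_i : i \in \mathbb{Z}_n\}$ and edges $u_iu_{i+1}$, $v_iv_{i+k}$, $u_iv_i$, $u_iv_{i+a}$, $u_iv_{i+b}$, $u_iv_{i+c}$ for $i \in \mathbb{Z}_n$ (indices modulo $n$); parameters written as expressions are taken modulo $n$ as residues in $\{1,\dots,n-1\}$. A graph is half-arc-transitive if its automorphism group acts transitively on vertices and edges but not on arcs. In a half-arc-transitive graph the automorphism group induces two mutually opposite orientations of the edges; fix one. An alternating path is a path whose consecutive edges are traversed alternately along and against the orientation. An edge $f$ is reachable from an edge $e$ if there is an alternating path whose first edge is $e$ and last edge is $f$; this reachability relation is an equivalence relation on edges (independent of the chosen orientation), its classes are called alternets, and it is universal if there is only one alternet. -}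

module Defs where

open import Data.Nat using (ℕ; zero; suc; _+_; _*_; _∸_)
open import Data.Nat.DivMod using (_mod_)
open import Data.Fin using (Fin; toℕ)
open import Data.Sum using (_⊎_; inj₁; inj₂)
open import Data.Product using (Σ; _×_; _,_; ∃)
open import Relation.Binary.PropositionalEquality using (_≡_)
open import Relation.Nullary using (¬_)

_⊕_ : ∀ {n} → Fin n → ℕ → Fin n
_⊕_ {suc n} i j = (toℕ i + j) mod (suc n)

-- Nest graph N(n; a, b, c; k).
-- Vertices: inj₁ i = u_i, inj₂ i = v_i   (i ∈ ℤ_n = Fin n).

NestV : ℕ → Set
NestV n = Fin n ⊎ Fin n

UV : ∀ {n} → ℕ → ℕ → ℕ → Fin n → Fin n → Set
UV a b c i j = (j ≡ i) ⊎ (j ≡ i ⊕ a) ⊎ (j ≡ i ⊕ b) ⊎ (j ≡ i ⊕ c)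

NestAdj : (n a b c k : ℕ) → NestV n → NestV n → Set
NestAdj n a b c k (inj₁ i) (inj₁ j) = (j ≡ i ⊕ 1) ⊎ (i ≡ j ⊕ 1)
NestAdj n a b c k (inj₂ i) (inj₂ j) = (j ≡ i ⊕ k) ⊎ (i ≡ j ⊕ k)
NestAdj n a b c k (inj₁ i) (inj₂ j) = UV a b c i j
NestAdj n a b c k (inj₂ j) (inj₁ i) = UV a b c i j

module _ {V : Set} (Adj : V → V → Set) where

  record Aut : Set where
    field
      to       : V → V
      from     : V → V
      to-from  : ∀ x → to (from x) ≡ x
      from-to  : ∀ x → from (to x) ≡ x
      preserve : ∀ x y → Adj x y → Adj (to x) (to y)
      reflect  : ∀ x y → Adj (to x) (to y) → Adj x y
  open Aut public

  VertexTransitive : Set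
  VertexTransitive = ∀ x y → Σ Aut λ σ → to σ x ≡ y

  EdgeTransitive : Set
  EdgeTransitive = ∀ x y x' y' → Adj x y → Adj x' y' →
    Σ Aut λ σ → (to σ x ≡ x' × to σ y ≡ y') ⊎ (to σ x ≡ y' × to σ y ≡ x')

  ArcTransitive : Set
  ArcTransitive = ∀ x y x' y' → Adj x y → Adj x' y' →
    Σ Aut λ σ → to σ x ≡ x' × to σ y ≡ y'

  HalfArcTransitive : Set
  HalfArcTransitive = VertexTransitive × EdgeTransitive × ¬ ArcTransitive

  -- The orientation induced by the automorphism group containing the
  -- arc (x₀ , y₀):  x → y  iff (x , y) is in the Aut-orbit of (x₀ , y₀).
  Oriented : V → V → V → V → Set
  Oriented x₀ y₀ x y = Σ Aut λ σ → to σ x₀ ≡ x × to σ y₀ ≡ y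

  -- Alternating walks w.r.t. an orientation D.
  -- AltWalk D a b c d : an alternating walk whose first edge is traversed
  -- from a to b and whose last edge is traversed from c to d; consecutive
  -- edges are traversed alternately along and against D.
  data AltWalk (D : V → V → Set) : V → V → V → V → Set where
    single : ∀ {a b} → Adj a b → AltWalk D a b a b
    step   : ∀ {a b c d e} → AltWalk D a b c d → Adj d e →
             (D c d × D e d) ⊎ (D d c × D d e) → AltWalk D a b d e

  Edge : Set
  Edge = Σ V λ x → Σ V λ y → Adj x y

  SameEnds : V → V → V → V → Set
  SameEnds x y a b = (a ≡ x × b ≡ y) ⊎ (a ≡ y × b ≡ x)

  Reachable : (D : V → V → Set) → Edge → Edge → Set
  Reachable D (x , y , _) (x' , y' , _) =
    Σ V λ a → Σ V λ b → Σ V λ c → Σ V λ d →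
      SameEnds x y a b × SameEnds x' y' c d × AltWalk D a b c d

  UniversalReachability : (D : V → V → Set) → Set
  UniversalReachability D = ∀ e f → Reachable D e f

  -- exactly three alternets (equivalence classes of reachability)
  ThreeAlternets : (D : V → V → Set) → Set
  ThreeAlternets D = Σ Edge λ e₁ → Σ Edge λ e₂ → Σ Edge λ e₃ →
    (¬ Reachable D e₁ e₂ × ¬ Reachable D e₂ e₁ ×
     ¬ Reachable D e₁ e₃ × ¬ Reachable D e₃ e₁ ×
     ¬ Reachable D e₂ e₃ × ¬ Reachable D e₃ e₂) ×
    (∀ f → Reachable D e₁ f ⊎ Reachable D e₂ f ⊎ Reachable D e₃ f)

ΓAdj : (b m : ℕ) → NestV (2 * m) → NestV (2 * m) → Set
ΓAdj b m = NestAdj (2 * m) 1 b (b + m + 1) (m ∸ 1)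

{-# OPTIONS --safe #-}
module Submission where

-- Put m = 2k, so that k is odd and n = 4k, and h = k - 2b₀.  Then h is odd, h² + h + 1 is an odd
-- multiple of k, b = 2k - 2h - 1 and b + m + 1 ≡ -2h (mod n).  So 2h behaves like 2ω̄ for a primitive
-- cube root of unity ω̄: drawing u_i at i and v_i at i + ω̄, the graph becomes a quotient of a double
-- cover of the triangular lattice, the six neighbours lying at ±1, ±ω, ±ω̄.  The steps by 1, ω̄ and ω
-- are permutations of the vertices; they define an orientation D that consists of directed triangles.
-- Rotations and a map exchanging the u's and the v's commute with the steps, and multiplication by ω̄
-- permutes them cyclically, so that these automorphisms are transitive on the arcs of D.
--
-- An automorphism σ reversing u₀u₁ would reverse the whole rim: 5-cycles (which are those of the
-- lattice, as a vector of the kernel has squared length at least n ≥ 28) single out the 2-paths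
-- v_i u_i v_{i+1}, hence the straight 2-paths u_{i-1} u_i u_{i+1}.  Thus u_i ↦ u_{1-i} and
-- v_i ↦ v_{2-i}, which does not map the edge u₀v_b to an edge.  Hence D and its opposite are the
-- orientations induced by the automorphism group.
--
-- Two arcs of D with a common head have tails that differ by a multiple of 1 - ω.  If 3 ∤ m, such
-- differences connect everything; if 3 ∣ m, then i ↦ i mod 3 (shifted by 1 on the v's) is a
-- 3-colouring in which every arc of D raises the colour by 1, and the alternets are the sets of arcs
-- whose tail has a given colour.

open import Defs
open import Data.Empty using (⊥; ⊥-elim)
open import Data.Nat using (ℕ; zero; suc; s≤s; _∸_; _^_; _<_; _%_)
import Data.Nat as ℕ
import Data.Nat.Divisibility as ℕ∣
open import Data.Nat.Divisibility using (_∣_)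
import Data.Nat.Properties as ℕₚ
open import Data.Product using (Σ; ∃; _×_; _,_; proj₁; proj₂)
open import Data.Sum using (_⊎_; inj₁; inj₂; [_,_]′)
open import Function.Bundles using (_⇔_; mk⇔)
open import Relation.Binary.PropositionalEquality
open import Relation.Nullary using (¬_; Dec; yes; no)
open import Relation.Nullary.Decidable using (_×-dec_; _→-dec_; ¬?; toWitness)

module NestGraph where

  open import Data.Bool using (Bool; true; false; not)
  import Data.Bool.Properties as Boolₚ
  open import Data.Fin using (Fin; toℕ; fromℕ<)
  import Data.Fin.Properties as Finₚ
  open import Data.Integer using (ℤ; +_; -[1+_]; _+_; _*_; -_; _-_; ∣_∣)
  import Data.Integer as ℤ
  import Data.Integer.Properties as ℤₚ
  open import Data.Integer.DivMod using (_%ℕ_; _/ℕ_; n%ℕd<d; a≡a%ℕn+[a/ℕn]*n)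
  open import Data.Integer.Tactic.RingSolver using (solve; solve-∀)
  open import Data.List using (List; []; _∷_)
  import Data.List.Membership.DecPropositional as DecMembership
  open import Data.List.Relation.Unary.All as All using (All)
  open import Data.List.Relation.Unary.Any as Any using (Any; here; there)
  open import Data.Nat.DivMod using (m≡m%n+[m/n]*n)
  import Data.Nat.Tactic.RingSolver as ℕSolver
  open import Data.Product.Properties using (≡-dec)
  open import Data.Sum.Properties using (inj₁-injective; inj₂-injective)
  open import Relation.Binary.Definitions using (DecidableEquality)

  -- Integer arithmetic: linear combinations, parity, residues.

  by-hyp : ∀ {p q x y} c → p ≡ q → x + c * q ≡ y + c * p → x ≡ y
  -- With x - y = c (p - q) as polynomials, the hypothesis p = q gives x = y. The multiplier c is
  -- supplied by hand and the polynomial identity is left to the ring solver.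
  by-hyp {p} {q} {x} {y} c refl eq = trans (lem x (c * p)) (trans (cong (λ z → z - c * p) eq) (sym (lem y (c * p))))
    where lem : ∀ a b → a ≡ a + b - b
          lem = solve-∀

  halve : ∀ {x y} → + 2 * x ≡ + 2 * y → x ≡ y
  halve {x} {y} = ℤₚ.*-cancelˡ-≡ (+ 2) x y

  2z≢1 : ∀ z → ¬ (+ 2 * z ≡ + 1)
  2z≢1 z eq with ∣ z ∣ | trans (sym (ℤₚ.abs-* (+ 2) z)) (cong ∣_∣ eq)
  ... | suc n | p with trans (sym (ℕₚ.+-suc n (n ℕ.+ 0))) (ℕₚ.suc-injective p)
  ...   | ()

  data Parity (x : ℤ) : Set where
    even : ∀ j → x ≡ + 2 * j → Parity x
    odd  : ∀ j → x ≡ + 2 * j + + 1 → Parity x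

  parity : ∀ x → Parity x
  parity x with x %ℕ 2 | n%ℕd<d x 2 | a≡a%ℕn+[a/ℕn]*n x 2
  ... | 0 | _ | eq = even (x /ℕ 2) (trans eq (lem (x /ℕ 2)))
    where lem : ∀ z → + 0 + z * + 2 ≡ + 2 * z
          lem = solve-∀
  ... | 1 | _ | eq = odd (x /ℕ 2) (trans eq (lem (x /ℕ 2)))
    where lem : ∀ z → + 1 + z * + 2 ≡ + 2 * z + + 1
          lem = solve-∀
  ... | suc (suc _) | s≤s (s≤s ()) | _

  -- A positive quotient would make r at least n; a negative one becomes positive when r and r' are
  -- exchanged.
  residue-unique : ∀ {n r r'} q → r ℕ.< n → r' ℕ.< n → + r ≡ + r' + q * + n → r ≡ r'
  residue-unique {n} {r} {r'} (+ zero) _ _ eq = trans (ℤₚ.+-injective eq) (ℕₚ.+-identityʳ r')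
  residue-unique {n} {r} {r'} (+ suc q) r< _ eq = ⊥-elim (ℕₚ.<⇒≱ r< (begin
    n                         ≤⟨ ℕₚ.m≤m+n n _ ⟩
    n ℕ.+ q ℕ.* n             ≤⟨ ℕₚ.m≤n+m _ r' ⟩
    r' ℕ.+ suc q ℕ.* n        ≡⟨ ℤₚ.+-injective (sym (trans eq (cong (λ z → + r' + z) (sym (ℤₚ.pos-* (suc q) n))))) ⟩
    r                         ∎))
    where open ℕₚ.≤-Reasoning
  residue-unique {n} {r} {r'} -[1+ q ] r< r'< eq =
    sym (residue-unique (+ suc q) r'< r< (lem (+ r) (+ r') (+ suc q) (+ n) eq))
    where lem : ∀ a b c d → a ≡ b + (- c) * d → b ≡ a + c * d
          lem a b c d refl = solve (b ∷ c ∷ d ∷ [])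

  -- The triangular lattice and its double cover.

  data Side : Set where
    u v : Side

  data Dir : Set where
    𝟙 ω̄ ω : Dir

  next : Dir → Dir
  next 𝟙 = ω̄
  next ω̄ = ω
  next ω = 𝟙

  -- A vertex of the double cover: (s , p , q , r) lies over the vertex of side s and index p + 2hq + 2kr.
  Sym : Set
  Sym = Side × ℤ × ℤ × Bool

  moveˢ backˢ : Dir → Sym → Sym
  moveˢ 𝟙 (u , p , q , r) = u , p + + 1 , q , r
  moveˢ 𝟙 (v , p , q , r) = v , p + + 1 , q , not r
  moveˢ ω̄ (u , p , q , r) = v , p , q , r
  moveˢ ω̄ (v , p , q , r) = u , p , q + + 1 , r
  moveˢ ω (u , p , q , r) = v , p - + 1 , q - + 1 , not r
  moveˢ ω (v , p , q , r) = u , p - + 1 , q , r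
  backˢ 𝟙 (u , p , q , r) = u , p - + 1 , q , r
  backˢ 𝟙 (v , p , q , r) = v , p - + 1 , q , not r
  backˢ ω̄ (u , p , q , r) = v , p , q - + 1 , r
  backˢ ω̄ (v , p , q , r) = u , p , q , r
  backˢ ω (u , p , q , r) = v , p + + 1 , q , r
  backˢ ω (v , p , q , r) = u , p + + 1 , q + + 1 , not r

  private
    down-up : ∀ x → x - + 1 + + 1 ≡ x
    down-up = solve-∀

    up-down : ∀ x → x + + 1 - + 1 ≡ x
    up-down = solve-∀

  move-back : ∀ s x → moveˢ s (backˢ s x) ≡ x
  move-back 𝟙 (u , p , q , r) = cong (λ p → u , p , q , r) (down-up p)
  move-back 𝟙 (v , p , q , r) = cong₂ (λ p r → v , p , q , r) (down-up p) (Boolₚ.not-involutive r)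
  move-back ω̄ (u , p , q , r) = cong (λ q → u , p , q , r) (down-up q)
  move-back ω̄ (v , p , q , r) = refl
  move-back ω (u , p , q , r) = cong (λ p → u , p , q , r) (up-down p)
  move-back ω (v , p , q , r) = cong₂ (λ (p , q) r → v , p , q , r)
    (cong₂ _,_ (up-down p) (up-down q)) (Boolₚ.not-involutive r)

  nbrs : Sym → List Sym
  nbrs x = moveˢ 𝟙 x ∷ moveˢ ω̄ x ∷ moveˢ ω x ∷ backˢ 𝟙 x ∷ backˢ ω̄ x ∷ backˢ ω x ∷ []

  -- |p + 2qω̄|².
  norm : ℤ → ℤ → ℤ
  norm p q = p * p - + 2 * (p * q) + + 4 * (q * q)

  -- Points this close have the same image in the graph only if they are equal, because the norm of
  -- a kernel vector is a multiple of 4k, and 4k is at least 28. The second condition is the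
  -- definiteness of the norm, here decided for the concrete pair at hand.
  Near : Sym → Sym → Set
  Near (_ , p , q , _) (_ , p' , q' , _) =
    ∣ norm (p - p') (q - q') ∣ ℕ.< 28 × (norm (p - p') (q - q') ≡ + 0 → p ≡ p' × q ≡ q')

  near? : ∀ x y → Dec (Near x y)
  near? (_ , p , q , _) (_ , p' , q' , _) =
    (∣ norm (p - p') (q - q') ∣ ℕ.<? 28) ×-dec
    ((norm (p - p') (q - q') ℤₚ.≟ + 0) →-dec ((p ℤₚ.≟ p') ×-dec (q ℤₚ.≟ q')))

  _≟ₛ_ : DecidableEquality Side
  u ≟ₛ u = yes refl
  u ≟ₛ v = no λ ()
  v ≟ₛ u = no λ ()
  v ≟ₛ v = yes refl

  _≟_ : DecidableEquality Sym
  _≟_ = ≡-dec _≟ₛ_ (≡-dec ℤₚ._≟_ (≡-dec ℤₚ._≟_ Boolₚ._≟_))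

  -- Common neighbours and 5-cycles around `u₀`, decided in the cover.

  open DecMembership _≟_ using (_∈_; _∈?_)

  -- The two 5-cycles through the path v₀, u₀, v₁ that are used below are u₀, v₀, aᵢ, bᵢ, v₁ for i =
  -- 1, 2.
  u₋₁ u₀ u₁ v₀ v₁ a₁ b₁ a₂ b₂ : Sym
  u₋₁ = u , -[1+ 0 ] , + 0 , false
  u₀ = u , + 0 , + 0 , false
  u₁ = u , + 1 , + 0 , false
  v₀ = v , + 0 , + 0 , false
  v₁ = v , + 1 , + 0 , false
  a₁ = u , + 0 , + 1 , false
  b₁ = u , + 1 , + 1 , false
  a₂ = u , + 1 , + 1 , true
  b₂ = u , + 2 , + 1 , true

  -- For a neighbour x of v₁: the path x, v₁, u₀, w lies on a 5-cycle.
  Pentagon : Sym → Sym → Set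
  Pentagon w x = x ≢ u₀ × ¬ (x ∈ nbrs u₀) × Any (_∈ nbrs w) (nbrs x)

  pentagon? : ∀ w x → Dec (Pentagon w x)
  pentagon? w x = ¬? (x ≟ u₀) ×-dec (¬? (x ∈? nbrs u₀) ×-dec Any.any? (_∈? nbrs w) (nbrs x))

  CommonNear : Sym → Sym → Set
  CommonNear x y = All (λ z → All (Near z) (nbrs y)) (nbrs x)

  commonNear? : ∀ x y → Dec (CommonNear x y)
  commonNear? x y = All.all? (λ z → All.all? (near? z) (nbrs y)) (nbrs x)

  abstract
    -- A finite check that characterises `v₀` by data an automorphism preserves: x and y are two
    -- ways to continue w, u₀, v₁ towards a 5-cycle, and the last two conditions on w exclude `v₁`
    -- and its triangle with `u₀`.
    two-pentagons : All (λ w → All (λ x → All (λ y →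
      Pentagon w x → Pentagon w y → x ≢ y → ¬ (w ∈ nbrs v₁) → w ≢ v₁ → w ≡ v₀)
      (nbrs v₁)) (nbrs v₁)) (nbrs u₀)
    two-pentagons = toWitness {a? = All.all? (λ w → All.all? (λ x → All.all? (λ y →
      pentagon? w x →-dec (pentagon? w y →-dec (¬? (x ≟ y) →-dec
        (¬? (w ∈? nbrs v₁) →-dec (¬? (w ≟ v₁) →-dec (w ≟ v₀)))))) (nbrs v₁)) (nbrs v₁)) (nbrs u₀)} _

    -- Guarantees that a 5-cycle of the graph, lifted vertex by vertex from u₀, v₁, closes up in the
    -- cover.
    pentagon-near : All (λ w → All (λ x → All (λ y → All (λ z → Near y z) (nbrs w)) (nbrs x)) (nbrs v₁)) (nbrs u₀)
    pentagon-near = toWitness {a? = All.all? (λ w → All.all? (λ x → All.all? (λ y → All.all? (near? y)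
      (nbrs w)) (nbrs x)) (nbrs v₁)) (nbrs u₀)} _

    common-u₀-u₁ : All (λ z → z ∈ nbrs u₁ → z ≡ v₁) (nbrs u₀)
    common-u₀-u₁ = toWitness {a? = All.all? (λ z → (z ∈? nbrs u₁) →-dec (z ≟ v₁)) (nbrs u₀)} _

    common-u₀-v₀ : All (λ z → z ∈ nbrs v₀ → z ≡ u₋₁) (nbrs u₀)
    common-u₀-v₀ = toWitness {a? = All.all? (λ z → (z ∈? nbrs v₀) →-dec (z ≟ u₋₁)) (nbrs u₀)} _

  Pos : Set
  Pos = Side × ℤ

  -- N(4k; 1, 2k-2h-1, 4k-2h; 2k-1).
  module Nest
    (n' kn bn cn dn : ℕ) (k h g e : ℤ)
    (n≡ : suc n' ≡ 4 ℕ.* kn)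
    (7≤k : 7 ℕ.≤ kn)
    (k≡ : k ≡ + kn)
    (h≡ : h ≡ + 2 * g + + 1)
    (hh : h * h + h + + 1 ≡ k * (+ 2 * e + + 1))
    (b≡ : + bn ≡ + 2 * k - + 2 * h - + 1)
    (c≡ : + cn ≡ + 4 * k - + 2 * h)
    (d≡ : + dn ≡ + 2 * k - + 1)
    where

    -- Residues modulo 4k, handled through integers.

    N : ℕ
    N = suc n'

    V : Set
    V = NestV N

    Adj : V → V → Set
    Adj = NestAdj N 1 bn cn dn

    N≡4k : + N ≡ + 4 * k
    N≡4k = trans (cong +_ n≡) (trans (ℤₚ.pos-* 4 kn) (cong (λ z → + 4 * z) (sym k≡)))

    infix 4 _≋_ _≈_

    record _≋_ (x y : ℤ) : Set where
      constructor wit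
      field
        quot  : ℤ
        equal : x ≡ y + quot * (+ 4 * k)

    -- `wit` with both ends explicit, so that the ring solver meets a goal without metavariables.
    mod : ∀ x y q → x ≡ y + q * (+ 4 * k) → x ≋ y
    mod x y q = wit q

    ≡⇒≋ : ∀ {x y} → x ≡ y → x ≋ y
    ≡⇒≋ {x} refl = wit (+ 0) (solve (x ∷ k ∷ []))

    ≋-sym : ∀ {x y} → x ≋ y → y ≋ x
    ≋-sym {x} {y} (wit q refl) = wit (- q) (solve (y ∷ q ∷ k ∷ []))

    ≋-trans : ∀ {x y z} → x ≋ y → y ≋ z → x ≋ z
    ≋-trans {z = z} (wit q refl) (wit r refl) = wit (q + r) (solve (z ∷ q ∷ r ∷ k ∷ []))

    ≋-+ : ∀ {x y} z → x ≋ y → x + z ≋ y + z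
    ≋-+ {y = y} z (wit q refl) = wit q (solve (y ∷ z ∷ q ∷ k ∷ []))

    ≋-* : ∀ {x y} z → x ≋ y → z * x ≋ z * y
    ≋-* {y = y} z (wit q refl) = wit (z * q) (solve (y ∷ z ∷ q ∷ k ∷ []))

    -- The division inside `π` stays hidden; later arguments rest on `toℕ-π` and `⊕-π`.
    abstract
      π : ℤ → Fin N
      π x = fromℕ< (n%ℕd<d x N)

      toℕ-π : ∀ x → + toℕ (π x) ≋ x
      toℕ-π x = ≋-sym (wit (x /ℕ N) (begin
        x                                    ≡⟨ a≡a%ℕn+[a/ℕn]*n x N ⟩
        + (x %ℕ N) + (x /ℕ N) * + N          ≡⟨ cong₂ (λ r s → + r + (x /ℕ N) * s)
                                                 (sym (Finₚ.toℕ-fromℕ< (n%ℕd<d x N))) N≡4k ⟩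
        + toℕ (π x) + (x /ℕ N) * (+ 4 * k)   ∎))
        where open ≡-Reasoning

      ⊕-π : ∀ i a → i ⊕ a ≡ π (+ toℕ i + + a)
      ⊕-π i a = refl

    toℕ-≋-injective : ∀ {i j : Fin N} → + toℕ i ≋ + toℕ j → i ≡ j
    toℕ-≋-injective {i} {j} (wit q eq) = Finₚ.toℕ-injective
      (residue-unique q (Finₚ.toℕ<n i) (Finₚ.toℕ<n j)
        (trans eq (cong (λ s → + toℕ j + q * s) (sym N≡4k))))

    π-cong : ∀ {x y} → x ≋ y → π x ≡ π y
    π-cong {x} {y} x≋y = toℕ-≋-injective (≋-trans (toℕ-π x) (≋-trans x≋y (≋-sym (toℕ-π y))))

    π-injective : ∀ {x y} → π x ≡ π y → x ≋ y
    π-injective {x} {y} eq =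
      ≋-trans (≋-sym (toℕ-π x)) (≋-trans (≡⇒≋ (cong (λ i → + toℕ i) eq)) (toℕ-π y))

    π-toℕ : ∀ i → π (+ toℕ i) ≡ i
    π-toℕ i = toℕ-≋-injective (toℕ-π (+ toℕ i))

    π-⊕ : ∀ x a → π x ⊕ a ≡ π (x + + a)
    π-⊕ x a = trans (⊕-π (π x) a) (π-cong (≋-+ (+ a) (toℕ-π x)))

    pt : Pos → V
    pt (u , x) = inj₁ (π x)
    pt (v , x) = inj₂ (π x)

    rep : V → Pos
    rep (inj₁ i) = u , + toℕ i
    rep (inj₂ i) = v , + toℕ i

    record _≈_ (a b : Pos) : Set where
      constructor _&_
      field
        side  : proj₁ a ≡ proj₁ b
        index : proj₂ a ≋ proj₂ b

    pt-cong : ∀ {a b} → a ≈ b → pt a ≡ pt b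
    pt-cong {u , _} (refl & x≋y) = cong inj₁ (π-cong x≋y)
    pt-cong {v , _} (refl & x≋y) = cong inj₂ (π-cong x≋y)

    pt-injective : ∀ {a b} → pt a ≡ pt b → a ≈ b
    pt-injective {u , _} {u , _} eq = refl & π-injective (inj₁-injective eq)
    pt-injective {v , _} {v , _} eq = refl & π-injective (inj₂-injective eq)

    pt-rep : ∀ x → pt (rep x) ≡ x
    pt-rep (inj₁ i) = cong inj₁ (π-toℕ i)
    pt-rep (inj₂ i) = cong inj₂ (π-toℕ i)

    elim-pt : ∀ {ℓ} {P : V → Set ℓ} → (∀ a → P (pt a)) → ∀ x → P x
    elim-pt {P = P} p x = subst P (pt-rep x) (p (rep x))

    Respects : (Pos → Pos) → Set
    Respects f = ∀ {a b} → a ≈ b → f a ≈ f b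

    lift : (Pos → Pos) → V → V
    lift f x = pt (f (rep x))

    lift-pt : ∀ {f} → Respects f → ∀ a → lift f (pt a) ≡ pt (f a)
    lift-pt resp a = pt-cong (resp (pt-injective (pt-rep (pt a))))

    -- The three steps and the orientation `D`.

    move : Dir → Pos → Pos
    move 𝟙 (u , x) = u , x + + 1
    -- The edges between v's are traversed against their defining direction: -(2k - 1) ≡ 2k + 1 (mod
    -- 4k).
    move 𝟙 (v , x) = v , x + (+ 2 * k + + 1)
    move ω̄ (u , x) = v , x
    -- This is the spoke with parameter b + m + 1 ≡ -2h, traversed from its v to its u.
    move ω̄ (v , x) = u , x + + 2 * h
    move ω (u , x) = v , x + (+ 2 * k - + 2 * h - + 1)
    move ω (v , x) = u , x + - (+ 1)

    move-resp : ∀ s → Respects (move s)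
    move-resp 𝟙 {u , _} (refl & p) = refl & ≋-+ _ p
    move-resp 𝟙 {v , _} (refl & p) = refl & ≋-+ _ p
    move-resp ω̄ {u , _} (refl & p) = refl & p
    move-resp ω̄ {v , _} (refl & p) = refl & ≋-+ _ p
    move-resp ω {u , _} (refl & p) = refl & ≋-+ _ p
    move-resp ω {v , _} (refl & p) = refl & ≋-+ _ p

    R : Dir → V → V
    R s = lift (move s)

    R-pt : ∀ s a → R s (pt a) ≡ pt (move s a)
    R-pt s = lift-pt (move-resp s)

    U W : ℤ → V
    U x = inj₁ (π x)
    W x = inj₂ (π x)

    U≡ : ∀ {x y} → x ≋ y → U x ≡ U y
    U≡ x≋y = cong inj₁ (π-cong x≋y)

    W≡ : ∀ {x y} → x ≋ y → W x ≡ W y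
    W≡ x≋y = cong inj₂ (π-cong x≋y)

    -- In the Eisenstein picture, 1 + ω̄ + ω = 0.
    triangle : ∀ s x → R (next (next s)) (R (next s) (R s x)) ≡ x
    triangle s = elim-pt (λ a → trans (cong (λ z → R _ (R _ z)) (R-pt s a))
      (trans (cong (R _) (R-pt _ (move s a))) (trans (R-pt _ _) (closed s a))))
      where
      closed : ∀ s a → pt (move (next (next s)) (move (next s) (move s a))) ≡ pt a
      closed 𝟙 (u , x) = U≡ (≡⇒≋ (solve (x ∷ [])))
      closed 𝟙 (v , x) = W≡ (wit (+ 1) (solve (x ∷ k ∷ h ∷ [])))
      closed ω̄ (u , x) = U≡ (≡⇒≋ (solve (x ∷ [])))
      closed ω̄ (v , x) = W≡ (wit (+ 1) (solve (x ∷ k ∷ h ∷ [])))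
      closed ω (u , x) = U≡ (wit (+ 1) (solve (x ∷ k ∷ h ∷ [])))
      closed ω (v , x) = W≡ (≡⇒≋ (solve (x ∷ [])))

    D : V → V → Set
    D x y = Σ Dir λ s → y ≡ R s x

    D⇒Adj : ∀ {x y} → D x y → Adj x y
    D⇒Adj {inj₁ i} (𝟙 , refl) = inj₁ (sym (⊕-π i 1))
    D⇒Adj {inj₁ i} (ω̄ , refl) = inj₁ (π-toℕ i)
    D⇒Adj {inj₁ i} (ω , refl) =
      inj₂ (inj₂ (inj₁ (trans (cong (λ z → π (+ toℕ i + z)) (sym b≡)) (sym (⊕-π i bn)))))
    D⇒Adj {inj₂ i} (𝟙 , refl) = inj₂ (sym (trans (π-⊕ _ dn) (trans (π-cong
      (wit (+ 1) (trans (cong (λ z → + toℕ i + (+ 2 * k + + 1) + z) d≡) (lem (+ toℕ i) k)))) (π-toℕ i))))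
      where lem : ∀ x k → x + (+ 2 * k + + 1) + (+ 2 * k - + 1) ≡ x + + 1 * (+ 4 * k)
            lem = solve-∀
    D⇒Adj {inj₂ i} (ω̄ , refl) = inj₂ (inj₂ (inj₂ (sym (trans (π-⊕ _ cn) (trans (π-cong
      (wit (+ 1) (trans (cong (λ z → + toℕ i + + 2 * h + z) c≡) (lem (+ toℕ i) k h)))) (π-toℕ i))))))
      where lem : ∀ x k h → x + + 2 * h + (+ 4 * k - + 2 * h) ≡ x + + 1 * (+ 4 * k)
            lem = solve-∀
    D⇒Adj {inj₂ i} (ω , refl) = inj₂ (inj₁ (sym (trans (π-⊕ _ 1) (trans (π-cong
      (≡⇒≋ (lem (+ toℕ i)))) (π-toℕ i)))))
      where lem : ∀ x → x + - (+ 1) + + 1 ≡ x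
            lem = solve-∀

    Adj-sym : ∀ {x y} → Adj x y → Adj y x
    Adj-sym {inj₁ _} {inj₁ _} = [ inj₂ , inj₁ ]′
    Adj-sym {inj₁ _} {inj₂ _} p = p
    Adj-sym {inj₂ _} {inj₁ _} p = p
    Adj-sym {inj₂ _} {inj₂ _} = [ inj₂ , inj₁ ]′

    private
      spoke : ∀ {i j} → UV 1 bn cn i j → D (inj₁ i) (inj₂ j) ⊎ D (inj₂ j) (inj₁ i)
      spoke {i} (inj₁ refl) = inj₁ (ω̄ , cong inj₂ (sym (π-toℕ i)))
      spoke {i} (inj₂ (inj₁ refl)) = inj₂ (ω , sym (trans (cong (λ j → R ω (inj₂ j)) (⊕-π i 1)) (trans (R-pt ω (v , + toℕ i + + 1))
        (trans (U≡ (≡⇒≋ (lem (+ toℕ i)))) (cong inj₁ (π-toℕ i))))))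
        where lem : ∀ x → x + + 1 + - (+ 1) ≡ x
              lem = solve-∀
      spoke {i} (inj₂ (inj₂ (inj₁ refl))) = inj₁ (ω , cong inj₂ (trans (⊕-π i bn) (cong (λ z → π (+ toℕ i + z)) b≡)))
      spoke {i} (inj₂ (inj₂ (inj₂ refl))) = inj₂ (ω̄ , sym (trans (cong (λ j → R ω̄ (inj₂ j)) (⊕-π i cn)) (trans (R-pt ω̄ (v , + toℕ i + + cn))
        (trans (U≡ (wit (+ 1) (trans (cong (λ z → + toℕ i + z + + 2 * h) c≡) (lem (+ toℕ i) k h))))
          (cong inj₁ (π-toℕ i))))))
        where lem : ∀ x k h → x + (+ 4 * k - + 2 * h) + + 2 * h ≡ x + + 1 * (+ 4 * k)
              lem = solve-∀

      hub : ∀ i → D (inj₂ (i ⊕ dn)) (inj₂ i)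
      hub i = 𝟙 , sym (trans (cong (λ j → R 𝟙 (inj₂ j)) (⊕-π i dn)) (trans (R-pt 𝟙 (v , + toℕ i + + dn))
        (trans (W≡ (wit (+ 1) (trans (cong (λ z → + toℕ i + z + (+ 2 * k + + 1)) d≡) (lem (+ toℕ i) k))))
          (cong inj₂ (π-toℕ i)))))
        where lem : ∀ x k → x + (+ 2 * k - + 1) + (+ 2 * k + + 1) ≡ x + + 1 * (+ 4 * k)
              lem = solve-∀

    Adj⇒D : ∀ {x y} → Adj x y → D x y ⊎ D y x
    Adj⇒D {inj₁ i} {inj₁ j} (inj₁ refl) = inj₁ (𝟙 , cong inj₁ (⊕-π i 1))
    Adj⇒D {inj₁ i} {inj₁ j} (inj₂ refl) = inj₂ (𝟙 , cong inj₁ (⊕-π j 1))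
    Adj⇒D {inj₁ i} {inj₂ j} p = spoke p
    Adj⇒D {inj₂ i} {inj₁ j} p = [ inj₂ , inj₁ ]′ (spoke p)
    Adj⇒D {inj₂ i} {inj₂ j} (inj₁ refl) = inj₂ (hub i)
    Adj⇒D {inj₂ i} {inj₂ j} (inj₂ refl) = inj₁ (hub j)

    -- Automorphisms that preserve the orientation.

    lift-square : ∀ {f g f' g'} → Respects f → Respects g → Respects f' → Respects g' →
      (∀ a → f (g a) ≈ f' (g' a)) → ∀ x → lift f (lift g x) ≡ lift f' (lift g' x)
    lift-square {f} {g} {f'} {g'} rf rg rf' rg' eq x = begin
      lift f (lift g x)     ≡⟨ lift-pt rf (g (rep x)) ⟩
      pt (f (g (rep x)))    ≡⟨ pt-cong (eq (rep x)) ⟩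
      pt (f' (g' (rep x)))  ≡⟨ lift-pt rf' (g' (rep x)) ⟨
      lift f' (lift g' x)   ∎
      where open ≡-Reasoning

    lift-inverse : ∀ {f g} → Respects f → (∀ a → f (g a) ≈ a) → ∀ x → lift f (lift g x) ≡ x
    lift-inverse {f} {g} rf eq x =
      trans (lift-pt rf (g (rep x))) (trans (pt-cong (eq (rep x))) (pt-rep x))

    Automorphism : Set
    Automorphism = Aut Adj

    arc-preserving : (f f⁻¹ : V → V) → (∀ x → f (f⁻¹ x) ≡ x) → (∀ x → f⁻¹ (f x) ≡ x) →
      (∀ {x y} → D x y → D (f x) (f y)) → (∀ {x y} → D x y → D (f⁻¹ x) (f⁻¹ y)) → Automorphism
    arc-preserving f f⁻¹ p q pres pres⁻¹ = record
      { to = f ; from = f⁻¹ ; to-from = p ; from-to = q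
      ; preserve = λ x y → adj pres
      ; reflect  = λ x y xy → subst₂ Adj (q x) (q y) (adj pres⁻¹ xy)
      }
      where
      adj : ∀ {h : V → V} → (∀ {x y} → D x y → D (h x) (h y)) → ∀ {x y} → Adj x y → Adj (h x) (h y)
      adj p xy = [ (λ d → D⇒Adj (p d)) , (λ d → Adj-sym (D⇒Adj (p d))) ]′ (Adj⇒D xy)

    infixr 9 _∙_
    _∙_ : Automorphism → Automorphism → Automorphism
    σ ∙ τ = record
      { to = λ x → to σ (to τ x) ; from = λ x → from τ (from σ x)
      ; to-from = λ x → trans (cong (to σ) (to-from τ _)) (to-from σ x)
      ; from-to = λ x → trans (cong (from τ) (from-to σ _)) (from-to τ x)
      ; preserve = λ x y p → preserve σ _ _ (preserve τ x y p)
      ; reflect = λ x y p → reflect τ x y (reflect σ _ _ p)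
      }

    _⁻¹ : Automorphism → Automorphism
    σ ⁻¹ = record
      { to = from σ ; from = to σ ; to-from = from-to σ ; from-to = to-from σ
      ; preserve = λ x y p → reflect σ _ _ (subst₂ Adj (sym (to-from σ x)) (sym (to-from σ y)) p)
      ; reflect = λ x y p → subst₂ Adj (to-from σ x) (to-from σ y) (preserve σ _ _ p)
      }

    Equivariant : (V → V) → Set
    Equivariant f = ∀ s x → f (R s x) ≡ R s (f x)

    equivariant-D : ∀ {f} → Equivariant f → ∀ {x y} → D x y → D (f x) (f y)
    equivariant-D eqv (s , refl) = s , eqv s _

    shift : ℤ → Pos → Pos
    shift z (s , x) = s , x + z

    shift-resp : ∀ z → Respects (shift z)
    shift-resp z (refl & p) = refl & ≋-+ z p

    rot : ℤ → V → V
    rot z = lift (shift z)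

    rot-equivariant : ∀ z → Equivariant (rot z)
    rot-equivariant z s = lift-square (shift-resp z) (move-resp s) (move-resp s) (shift-resp z) (eq s)
      where
      swap : ∀ x y z → x + y + z ≡ x + z + y
      swap = solve-∀
      eq : ∀ s a → shift z (move s a) ≈ move s (shift z a)
      eq 𝟙 (u , x) = refl & ≡⇒≋ (swap x _ z)
      eq 𝟙 (v , x) = refl & ≡⇒≋ (swap x _ z)
      eq ω̄ (u , x) = refl & ≡⇒≋ refl
      eq ω̄ (v , x) = refl & ≡⇒≋ (swap x _ z)
      eq ω (u , x) = refl & ≡⇒≋ (swap x _ z)
      eq ω (v , x) = refl & ≡⇒≋ (swap x _ z)

    rotation : ℤ → Automorphism
    rotation z = arc-preserving (rot z) (rot (- z))
      (lift-inverse {shift z} {shift (- z)} (shift-resp z) (λ a → refl & ≡⇒≋ (back (proj₂ a) z)))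
      (lift-inverse {shift (- z)} {shift z} (shift-resp (- z)) (λ a → refl & ≡⇒≋ (forth (proj₂ a) z)))
      (equivariant-D (rot-equivariant z)) (equivariant-D (rot-equivariant (- z)))
      where
      back : ∀ x z → x + - z + z ≡ x
      back = solve-∀
      forth : ∀ x z → x + z + - z ≡ x
      forth = solve-∀

    -- The translation by ω̄ of the lattice. Since (2k + 1)² = 1 + 4k (k + 1), multiplication by 2k
    -- + 1 is an involution modulo 4k; it exchanges the step 1 of the u's with the step 2k + 1 of
    -- the v's and fixes even residues such as 2h.
    swapᵖ swapᵖ⁻¹ : Pos → Pos
    swapᵖ (u , x) = v , (+ 2 * k + + 1) * x
    swapᵖ (v , x) = u , (+ 2 * k + + 1) * x + + 2 * h
    swapᵖ⁻¹ (u , x) = v , (+ 2 * k + + 1) * (x + - (+ 2 * h))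
    swapᵖ⁻¹ (v , x) = u , (+ 2 * k + + 1) * x

    swapᵖ-resp : Respects swapᵖ
    swapᵖ-resp {u , _} (refl & p) = refl & ≋-* (+ 2 * k + + 1) p
    swapᵖ-resp {v , _} (refl & p) = refl & ≋-+ (+ 2 * h) (≋-* (+ 2 * k + + 1) p)

    swapᵖ⁻¹-resp : Respects swapᵖ⁻¹
    swapᵖ⁻¹-resp {u , _} (refl & p) = refl & ≋-* (+ 2 * k + + 1) (≋-+ (- (+ 2 * h)) p)
    swapᵖ⁻¹-resp {v , _} (refl & p) = refl & ≋-* (+ 2 * k + + 1) p

    swapᵥ : V → V
    swapᵥ = lift swapᵖ

    swapᵥ-equivariant : Equivariant swapᵥ
    swapᵥ-equivariant s = lift-square swapᵖ-resp (move-resp s) (move-resp s) swapᵖ-resp (eq s)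
      where
      eq : ∀ s a → swapᵖ (move s a) ≈ move s (swapᵖ a)
      eq 𝟙 (u , x) = refl & mod ((+ 2 * k + + 1) * (x + + 1)) ((+ 2 * k + + 1) * x + (+ 2 * k + + 1)) (+ 0) (solve (x ∷ k ∷ []))
      eq 𝟙 (v , x) = refl & mod
          ((+ 2 * k + + 1) * (x + (+ 2 * k + + 1)) + + 2 * h) ((+ 2 * k + + 1) * x + + 2 * h + + 1) (k + + 1)
          (solve (x ∷ k ∷ h ∷ []))
      eq ω̄ (u , x) = refl & mod ((+ 2 * k + + 1) * x + + 2 * h) ((+ 2 * k + + 1) * x + + 2 * h) (+ 0) (solve (x ∷ k ∷ h ∷ []))
      eq ω̄ (v , x) = refl & mod ((+ 2 * k + + 1) * (x + + 2 * h)) ((+ 2 * k + + 1) * x + + 2 * h) (h) (solve (x ∷ k ∷ h ∷ []))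
      eq ω (u , x) = refl & mod
          ((+ 2 * k + + 1) * (x + (+ 2 * k - + 2 * h - + 1)) + + 2 * h) ((+ 2 * k + + 1) * x + - (+ 1)) (k - h)
          (solve (x ∷ k ∷ h ∷ []))
      eq ω (v , x) = refl & mod
          ((+ 2 * k + + 1) * (x + - (+ 1))) ((+ 2 * k + + 1) * x + + 2 * h + (+ 2 * k - + 2 * h - + 1)) (- (+ 1))
          (solve (x ∷ k ∷ h ∷ []))

    inverse-equivariant : ∀ {f f⁻¹} → (∀ x → f (f⁻¹ x) ≡ x) → (∀ x → f⁻¹ (f x) ≡ x) →
      Equivariant f → Equivariant f⁻¹
    inverse-equivariant {f} {f⁻¹} p q eqv s x = begin
      f⁻¹ (R s x)              ≡⟨ cong (λ z → f⁻¹ (R s z)) (p x) ⟨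
      f⁻¹ (R s (f (f⁻¹ x)))    ≡⟨ cong f⁻¹ (eqv s (f⁻¹ x)) ⟨
      f⁻¹ (f (R s (f⁻¹ x)))    ≡⟨ q _ ⟩
      R s (f⁻¹ x)              ∎
      where open ≡-Reasoning

    swapping : Automorphism
    swapping = arc-preserving swapᵥ (lift swapᵖ⁻¹) p q
      (equivariant-D swapᵥ-equivariant) (equivariant-D (inverse-equivariant p q swapᵥ-equivariant))
      where
      p = lift-inverse {swapᵖ} {swapᵖ⁻¹} swapᵖ-resp λ where
        (u , x) → refl & mod
            ((+ 2 * k + + 1) * ((+ 2 * k + + 1) * (x + - (+ 2 * h))) + + 2 * h) (x) ((k + + 1) * (x - + 2 * h))
            (solve (x ∷ k ∷ h ∷ []))
        (v , x) → refl & mod ((+ 2 * k + + 1) * ((+ 2 * k + + 1) * x)) (x) ((k + + 1) * x) (solve (x ∷ k ∷ []))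
      q = lift-inverse {swapᵖ⁻¹} {swapᵖ} swapᵖ⁻¹-resp λ where
        (u , x) → refl & mod ((+ 2 * k + + 1) * ((+ 2 * k + + 1) * x)) (x) ((k + + 1) * x) (solve (x ∷ k ∷ []))
        (v , x) → refl & mod ((+ 2 * k + + 1) * ((+ 2 * k + + 1) * x + + 2 * h + - (+ 2 * h))) (x) ((k + + 1) * x) (solve (x ∷ k ∷ h ∷ []))

    -- Multiplication by ω̄ (2ω̄ being represented by 2h): it fixes U 0 and permutes the steps 1 → ω̄ → ω → 1.
    turnᵖ : Side → ∀ {x} → Parity x → Pos
    turnᵖ u (even j _) = u , + 2 * (h * j)
    turnᵖ u (odd j _)  = v , + 2 * (h * j)
    -- The points are 2j + ω̄ and 2j + 1 + ω̄ = 2j - ω; their images are 2jω̄ + ω and 2jω̄ - 1.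
    turnᵖ v (even j _) = v , + 2 * (h * j) + (+ 2 * k - + 2 * h - + 1)
    turnᵖ v (odd j _)  = u , + 2 * (h * j) + - (+ 1)

    turn-double : ∀ {x y q} → + 2 * x ≡ + 2 * y + q * (+ 4 * k) → + 2 * (h * x) ≋ + 2 * (h * y)
    turn-double {x} {y} {q} eq = wit (h * q) (trans
      (cong (λ z → + 2 * (h * z)) (halve (trans eq (lem y q k)))) (lem' y q k h))
      where
      lem : ∀ y q k → + 2 * y + q * (+ 4 * k) ≡ + 2 * (y + q * (+ 2 * k))
      lem = solve-∀
      lem' : ∀ y q k h → + 2 * (h * (y + q * (+ 2 * k))) ≡ + 2 * (h * y) + h * q * (+ 4 * k)
      lem' = solve-∀

    -- The parities agree because the modulus is even. The parity witnesses are arbitrary, so that a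
    -- computed `parity x` can later be replaced by a convenient one.
    turnᵖ-resp : ∀ s {x y} (p : Parity x) (q : Parity y) → x ≋ y → turnᵖ s p ≈ turnᵖ s q
    turnᵖ-resp s (even i refl) (odd j refl) (wit q eq) = ⊥-elim (2z≢1 (i - j - q * (+ 2 * k)) (lem i j q k eq))
      where lem : ∀ i j q k → + 2 * i ≡ + 2 * j + + 1 + q * (+ 4 * k) → + 2 * (i - j - q * (+ 2 * k)) ≡ + 1
            lem i j q k eq = by-hyp (+ 1) eq (solve (i ∷ j ∷ q ∷ k ∷ []))
    turnᵖ-resp s (odd i refl) (even j refl) (wit q eq) = ⊥-elim (2z≢1 (j - i + q * (+ 2 * k)) (lem i j q k eq))
      where lem : ∀ i j q k → + 2 * i + + 1 ≡ + 2 * j + q * (+ 4 * k) → + 2 * (j - i + q * (+ 2 * k)) ≡ + 1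
            lem i j q k eq = by-hyp (- (+ 1)) eq (solve (i ∷ j ∷ q ∷ k ∷ []))
    turnᵖ-resp u (even i refl) (even j refl) (wit q eq) = refl & turn-double {q = q} eq
    turnᵖ-resp v (even i refl) (even j refl) (wit q eq) = refl & ≋-+ _ (turn-double {q = q} eq)
    turnᵖ-resp s (odd i refl) (odd j refl) (wit q eq) = onSide s
      where
      lem : ∀ i j q k → + 2 * i + + 1 ≡ + 2 * j + + 1 + q * (+ 4 * k) → + 2 * i ≡ + 2 * j + q * (+ 4 * k)
      lem i j q k eq = by-hyp (+ 1) eq (solve (i ∷ j ∷ q ∷ k ∷ []))
      onSide : ∀ s → turnᵖ s {+ 2 * i + + 1} (odd i refl) ≈ turnᵖ s {+ 2 * j + + 1} (odd j refl)
      onSide u = refl & turn-double {q = q} (lem i j q k eq)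
      onSide v = refl & ≋-+ _ (turn-double {q = q} (lem i j q k eq))

    turn : Pos → Pos
    turn (s , x) = turnᵖ s (parity x)

    turn-resp : Respects turn
    turn-resp {s , _} (refl & p) = turnᵖ-resp s (parity _) (parity _) p

    turnᵥ : V → V
    turnᵥ = lift turn

    ≈-trans : ∀ {a b c} → a ≈ b → b ≈ c → a ≈ c
    ≈-trans (refl & p) (refl & q) = refl & ≋-trans p q

    private
      -- This is where h odd enters: 2hk ≡ 2k (mod 4k).
      turn-𝟙-even : ∀ j k h g → h ≡ + 2 * g + + 1 →
        + 2 * (h * (j + k)) + - (+ 1) ≡ + 2 * (h * j) + (+ 2 * k - + 2 * h - + 1) + + 2 * h + g * (+ 4 * k)
      turn-𝟙-even j k h g eq = by-hyp (+ 2 * k) eq (solve (j ∷ k ∷ h ∷ g ∷ []))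

      turn-𝟙-odd : ∀ j k h g → h ≡ + 2 * g + + 1 →
        + 2 * (h * (j + k + + 1)) + (+ 2 * k - + 2 * h - + 1) ≡ + 2 * (h * j) + - (+ 1) + (g + + 1) * (+ 4 * k)
      turn-𝟙-odd j k h g eq = by-hyp (+ 2 * k) eq (solve (j ∷ k ∷ h ∷ g ∷ []))

      -- Since h² + h + 1 is an odd multiple of k, 2h² ≡ 2k - 2h - 2 (mod 4k); this plays the part
      -- of ω̄² = ω.
      turn-ω̄-even : ∀ j k h e → h * h + h + + 1 ≡ k * (+ 2 * e + + 1) →
        + 2 * (h * (j + h)) ≡ + 2 * (h * j) + (+ 2 * k - + 2 * h - + 1) + - (+ 1) + e * (+ 4 * k)
      turn-ω̄-even j k h e eq = by-hyp (+ 2) eq (solve (j ∷ k ∷ h ∷ e ∷ []))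

      turn-ω̄-odd : ∀ j k h e → h * h + h + + 1 ≡ k * (+ 2 * e + + 1) →
        + 2 * (h * (j + h)) ≡ + 2 * (h * j) + - (+ 1) + (+ 2 * k - + 2 * h - + 1) + e * (+ 4 * k)
      turn-ω̄-odd j k h e eq = by-hyp (+ 2) eq (solve (j ∷ k ∷ h ∷ e ∷ []))

    turn-𝟙 : ∀ a → turn (move 𝟙 a) ≈ move ω̄ (turn a)
    turn-𝟙 (u , x) with parity x
    ... | even j refl = turnᵖ-resp u (parity _) (odd j refl) (≡⇒≋ refl)
    ... | odd j refl = ≈-trans
      (turnᵖ-resp u (parity _) (even (j + + 1) refl)
        (mod (+ 2 * j + + 1 + + 1) (+ 2 * (j + + 1)) (+ 0) (solve (j ∷ k ∷ []))))
      (refl & mod (+ 2 * (h * (j + + 1))) (+ 2 * (h * j) + + 2 * h) (+ 0) (solve (j ∷ h ∷ k ∷ [])))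
    turn-𝟙 (v , x) with parity x
    ... | even j refl = ≈-trans
      (turnᵖ-resp v (parity _) (odd (j + k) refl)
        (mod (+ 2 * j + (+ 2 * k + + 1)) (+ 2 * (j + k) + + 1) (+ 0) (solve (j ∷ k ∷ []))))
      (refl & wit g (turn-𝟙-even j k h g h≡))
    ... | odd j refl = ≈-trans
      (turnᵖ-resp v (parity _) (even (j + k + + 1) refl)
        (mod (+ 2 * j + + 1 + (+ 2 * k + + 1)) (+ 2 * (j + k + + 1)) (+ 0) (solve (j ∷ k ∷ []))))
      (refl & wit (g + + 1) (turn-𝟙-odd j k h g h≡))

    turn-ω̄ : ∀ a → turn (move ω̄ a) ≈ move ω (turn a)
    turn-ω̄ (u , x) with parity x
    ... | even j refl = refl & ≡⇒≋ refl
    ... | odd j refl = refl & ≡⇒≋ refl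
    turn-ω̄ (v , x) with parity x
    ... | even j refl = ≈-trans
      (turnᵖ-resp u (parity _) (even (j + h) refl)
        (mod (+ 2 * j + + 2 * h) (+ 2 * (j + h)) (+ 0) (solve (j ∷ h ∷ k ∷ []))))
      (refl & wit e (turn-ω̄-even j k h e hh))
    ... | odd j refl = ≈-trans
      (turnᵖ-resp u (parity _) (odd (j + h) refl)
        (mod (+ 2 * j + + 1 + + 2 * h) (+ 2 * (j + h) + + 1) (+ 0) (solve (j ∷ h ∷ k ∷ []))))
      (refl & wit e (turn-ω̄-odd j k h e hh))

    turnᵥ-𝟙 : ∀ x → turnᵥ (R 𝟙 x) ≡ R ω̄ (turnᵥ x)
    turnᵥ-𝟙 = lift-square turn-resp (move-resp 𝟙) (move-resp ω̄) turn-resp turn-𝟙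

    turnᵥ-ω̄ : ∀ x → turnᵥ (R ω̄ x) ≡ R ω (turnᵥ x)
    turnᵥ-ω̄ = lift-square turn-resp (move-resp ω̄) (move-resp ω) turn-resp turn-ω̄

    turnᵥ-R : ∀ s x → turnᵥ (R s x) ≡ R (next s) (turnᵥ x)
    turnᵥ-R 𝟙 = turnᵥ-𝟙
    turnᵥ-R ω̄ = turnᵥ-ω̄
    -- The step ω is inverse to the product of the other two, for which the claim is known.
    turnᵥ-R ω x = begin
      turnᵥ (R ω x)                       ≡⟨ triangle ω̄ (turnᵥ (R ω x)) ⟨
      R 𝟙 (R ω (R ω̄ (turnᵥ (R ω x))))     ≡⟨ cong (λ z → R 𝟙 (R ω z)) (turnᵥ-𝟙 (R ω x)) ⟨
      R 𝟙 (R ω (turnᵥ (R 𝟙 (R ω x))))     ≡⟨ cong (R 𝟙) (turnᵥ-ω̄ (R 𝟙 (R ω x))) ⟨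
      R 𝟙 (turnᵥ (R ω̄ (R 𝟙 (R ω x))))     ≡⟨ cong (λ z → R 𝟙 (turnᵥ z)) (triangle ω x) ⟩
      R 𝟙 (turnᵥ x)                       ∎
      where open ≡-Reasoning

    -- From u₀ the step 𝟙 runs through all the u's, and ω̄ leads from the u's to all the v's.
    R-induction : ∀ {P : V → Set} → P (U (+ 0)) → (∀ s x → P x → P (R s x)) → ∀ x → P x
    R-induction {P} base ind = elim
      where
      onU : ∀ n → P (U (+ n))
      onU zero = base
      onU (suc n) = subst P (trans (R-pt 𝟙 (u , + n)) (U≡ (≡⇒≋ (ℤₚ.+-comm (+ n) (+ 1)))))
        (ind 𝟙 _ (onU n))
      elim : ∀ x → P x
      elim (inj₁ i) = subst P (pt-rep (inj₁ i)) (onU (toℕ i))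
      elim (inj₂ i) = subst P (trans (R-pt ω̄ (u , + toℕ i)) (pt-rep (inj₂ i))) (ind ω̄ _ (onU (toℕ i)))

    turnᵥ-0 : turnᵥ (U (+ 0)) ≡ U (+ 0)
    turnᵥ-0 = trans (lift-pt turn-resp (u , + 0))
      (trans (pt-cong (turnᵖ-resp u (parity (+ 0)) (even (+ 0) refl) (≡⇒≋ refl)))
        (U≡ (mod (+ 2 * (h * + 0)) (+ 0) (+ 0) (solve (h ∷ k ∷ [])))))

    -- The cube commutes with the steps, so it is the identity as soon as it fixes u₀.
    turnᵥ-cubed : ∀ x → turnᵥ (turnᵥ (turnᵥ x)) ≡ x
    turnᵥ-cubed = R-induction
      (trans (cong (λ z → turnᵥ (turnᵥ z)) turnᵥ-0) (trans (cong turnᵥ turnᵥ-0) turnᵥ-0))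
      (λ s x ih → trans (cong (λ z → turnᵥ (turnᵥ z)) (turnᵥ-R s x))
        (trans (cong turnᵥ (turnᵥ-R (next s) _)) (trans (turnᵥ-R (next (next s)) _)
          (cong₂ R (next-cubed s) ih))))
      where
      next-cubed : ∀ s → next (next (next s)) ≡ s
      next-cubed 𝟙 = refl
      next-cubed ω̄ = refl
      next-cubed ω = refl

    turning : Automorphism
    turning = arc-preserving turnᵥ (λ x → turnᵥ (turnᵥ x)) turnᵥ-cubed turnᵥ-cubed
      turn-D (λ d → turn-D (turn-D d))
      where turn-D : ∀ {x y} → D x y → D (turnᵥ x) (turnᵥ y)
            turn-D (s , refl) = next s , turnᵥ-R s _

    rot-U : ∀ z x → rot z (U x) ≡ U (x + z)
    rot-U z x = lift-pt (shift-resp z) (u , x)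

    rot-W : ∀ z x → rot z (W x) ≡ W (x + z)
    rot-W z x = lift-pt (shift-resp z) (v , x)

    vertex-transport : ∀ x → Σ Automorphism λ σ → to σ (U (+ 0)) ≡ x × Equivariant (to σ)
    vertex-transport (inj₁ i) = rotation (+ toℕ i) ,
      trans (rot-U (+ toℕ i) (+ 0)) (trans (U≡ (≡⇒≋ (ℤₚ.+-identityˡ _))) (pt-rep (inj₁ i))) ,
      rot-equivariant (+ toℕ i)
    vertex-transport (inj₂ i) = rotation (+ toℕ i) ∙ swapping ,
      trans (cong (rot (+ toℕ i)) (lift-pt swapᵖ-resp (u , + 0)))
        (trans (rot-W (+ toℕ i) _) (trans (W≡ (≡⇒≋ (lem (+ toℕ i) k))) (pt-rep (inj₂ i)))) ,
      λ s x → trans (cong (rot (+ toℕ i)) (swapᵥ-equivariant s x)) (rot-equivariant (+ toℕ i) s _)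
      where lem : ∀ i k → (+ 2 * k + + 1) * + 0 + i ≡ i
            lem = solve-∀

    -- First `fan s` turns u₀u₁ about u₀ into direction s; then an equivariant automorphism carries
    -- u₀ to x and keeps the direction.
    arc-transport : ∀ {x y} → D x y → Σ Automorphism λ σ → to σ (U (+ 0)) ≡ x × to σ (U (+ 1)) ≡ y
    arc-transport {x} (s , refl) with vertex-transport x
    ... | σ , σ0 , eqv = σ ∙ proj₁ (fan s) , trans (cong (to σ) (proj₁ (proj₂ (fan s)))) σ0 ,
      trans (cong (to σ) (proj₂ (proj₂ (fan s)))) (trans (eqv s _) (cong (R s) σ0))
      where
      U1 : U (+ 1) ≡ R 𝟙 (U (+ 0))
      U1 = sym (R-pt 𝟙 (u , + 0))
      fan : ∀ s → Σ Automorphism λ τ → to τ (U (+ 0)) ≡ U (+ 0) × to τ (U (+ 1)) ≡ R s (U (+ 0))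
      fan 𝟙 = rotation (+ 0) , trans (rot-U (+ 0) (+ 0)) refl , trans (rot-U (+ 0) (+ 1)) U1
      fan ω̄ = turning , turnᵥ-0 ,
        trans (cong turnᵥ U1) (trans (turnᵥ-𝟙 (U (+ 0))) (cong (R ω̄) turnᵥ-0))
      fan ω = turning ∙ turning , trans (cong turnᵥ turnᵥ-0) turnᵥ-0 ,
        trans (cong turnᵥ (trans (cong turnᵥ U1) (trans (turnᵥ-𝟙 (U (+ 0))) (cong (R ω̄) turnᵥ-0))))
          (trans (turnᵥ-ω̄ (U (+ 0))) (cong (R ω) turnᵥ-0))

    -- Evaluation of the cover in the graph and its injectivity on near points.

    bit : Bool → ℤ
    bit false = + 0
    bit true  = + 1

    value : ℤ → ℤ → Bool → ℤ
    value p q r = p + + 2 * h * q + + 2 * k * bit r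

    pos : Sym → Pos
    pos (s , p , q , r) = s , value p q r

    abstract
      eval : Sym → V
      eval x = pt (pos x)

      eval≡ : ∀ x → eval x ≡ pt (pos x)
      eval≡ x = refl

    R-eval : ∀ s x → R s (eval x) ≡ eval (moveˢ s x)
    R-eval s x = begin
      R s (eval x)          ≡⟨ cong (R s) (eval≡ x) ⟩
      R s (pt (pos x))      ≡⟨ R-pt s (pos x) ⟩
      pt (move s (pos x))   ≡⟨ eq s x ⟩
      pt (pos (moveˢ s x))  ≡⟨ eval≡ (moveˢ s x) ⟨
      eval (moveˢ s x)      ∎
      where
      open ≡-Reasoning
      eq : ∀ s x → pt (move s (pos x)) ≡ pt (pos (moveˢ s x))
      eq 𝟙 (u , p , q , r) = U≡ (mod _ _ (+ 0) (lem p q (bit r) h k))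
        where lem : ∀ p q r h k → p + + 2 * h * q + + 2 * k * r + + 1 ≡
                      p + + 1 + + 2 * h * q + + 2 * k * r + + 0 * (+ 4 * k)
              lem = solve-∀
      eq 𝟙 (v , p , q , false) = W≡ (mod _ _ (+ 0) (lem p q h k))
        where lem : ∀ p q h k → p + + 2 * h * q + + 2 * k * + 0 + (+ 2 * k + + 1) ≡
                      p + + 1 + + 2 * h * q + + 2 * k * + 1 + + 0 * (+ 4 * k)
              lem = solve-∀
      eq 𝟙 (v , p , q , true) = W≡ (mod _ _ (+ 1) (lem p q h k))
        where lem : ∀ p q h k → p + + 2 * h * q + + 2 * k * + 1 + (+ 2 * k + + 1) ≡
                      p + + 1 + + 2 * h * q + + 2 * k * + 0 + + 1 * (+ 4 * k)
              lem = solve-∀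
      eq ω̄ (u , p , q , r) = refl
      eq ω̄ (v , p , q , r) = U≡ (mod _ _ (+ 0) (lem p q (bit r) h k))
        where lem : ∀ p q r h k → p + + 2 * h * q + + 2 * k * r + + 2 * h ≡
                      p + + 2 * h * (q + + 1) + + 2 * k * r + + 0 * (+ 4 * k)
              lem = solve-∀
      eq ω (u , p , q , false) = W≡ (mod _ _ (+ 0) (lem p q h k))
        where lem : ∀ p q h k → p + + 2 * h * q + + 2 * k * + 0 + (+ 2 * k - + 2 * h - + 1) ≡
                      p - + 1 + + 2 * h * (q - + 1) + + 2 * k * + 1 + + 0 * (+ 4 * k)
              lem = solve-∀
      eq ω (u , p , q , true) = W≡ (mod _ _ (+ 1) (lem p q h k))
        where lem : ∀ p q h k → p + + 2 * h * q + + 2 * k * + 1 + (+ 2 * k - + 2 * h - + 1) ≡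
                      p - + 1 + + 2 * h * (q - + 1) + + 2 * k * + 0 + + 1 * (+ 4 * k)
              lem = solve-∀
      eq ω (v , p , q , r) = U≡ (mod _ _ (+ 0) (lem p q (bit r) h k))
        where lem : ∀ p q r h k → p + + 2 * h * q + + 2 * k * r + - (+ 1) ≡
                      p - + 1 + + 2 * h * q + + 2 * k * r + + 0 * (+ 4 * k)
              lem = solve-∀

    R-back : ∀ s x → R s (eval (backˢ s x)) ≡ eval x
    R-back s x = trans (R-eval s (backˢ s x)) (cong eval (move-back s x))

    R-injective : ∀ s {x y} → R s x ≡ R s y → x ≡ y
    R-injective s {x} {y} eq = trans (sym (triangle s x)) (trans (cong (λ z → R _ (R _ z)) eq) (triangle s y))

    move∈ : ∀ s x → moveˢ s x ∈ nbrs x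
    move∈ 𝟙 x = here refl
    move∈ ω̄ x = there (here refl)
    move∈ ω x = there (there (here refl))

    back∈ : ∀ s x → backˢ s x ∈ nbrs x
    back∈ 𝟙 x = there (there (there (here refl)))
    back∈ ω̄ x = there (there (there (there (here refl))))
    back∈ ω x = there (there (there (there (there (here refl)))))

    Adj-eval : ∀ x {z} → Adj (eval x) z → ∃ λ y → y ∈ nbrs x × z ≡ eval y
    Adj-eval x xz with Adj⇒D xz
    ... | inj₁ (s , eq) = moveˢ s x , move∈ s x , trans eq (R-eval s x)
    ... | inj₂ (s , eq) = backˢ s x , back∈ s x , R-injective s (trans (sym eq) (sym (R-back s x)))

    eval-Adj : ∀ x {y} → y ∈ nbrs x → Adj (eval x) (eval y)
    eval-Adj x y∈ = All.lookup {P = λ y → Adj (eval x) (eval y)}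
      (out 𝟙 All.∷ out ω̄ All.∷ out ω All.∷ inn 𝟙 All.∷ inn ω̄ All.∷ inn ω All.∷ All.[]) y∈
      where
      out : ∀ s → Adj (eval x) (eval (moveˢ s x))
      out s = D⇒Adj (s , sym (R-eval s x))
      inn : ∀ s → Adj (eval x) (eval (backˢ s x))
      inn s = Adj-sym (D⇒Adj (s , sym (R-back s x)))

    -- p + 2hq ≡ 0 (mod 2k) makes p even, and then norm p q is 4 times a value of the form
    -- a² - aq + q², which vanishes modulo k at a = -hq because h² + h + 1 does.
    norm-multiple : ∀ p q w → p ≡ + 2 * (k * w - h * q) →
      norm p q ≡ + 4 * k * (q * q * (+ 2 * e + + 1) - + 2 * h * q * w + k * w * w - w * q)
    norm-multiple p q w refl = by-hyp (+ 4 * (q * q)) hh (lem q w k h e)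
      where
      lem : ∀ q w k h e → (+ 2 * (k * w - h * q)) * (+ 2 * (k * w - h * q)) - + 2 * ((+ 2 * (k * w - h * q)) * q)
              + + 4 * (q * q) + + 4 * (q * q) * (k * (+ 2 * e + + 1)) ≡
        + 4 * k * (q * q * (+ 2 * e + + 1) - + 2 * h * q * w + k * w * w - w * q) + + 4 * (q * q) * (h * h + h + + 1)
      lem = solve-∀

    small-multiple : ∀ {x} y → x ≡ + 4 * k * y → ∣ x ∣ ℕ.< 28 → x ≡ + 0
    small-multiple {x} y eq x<28 with ∣ y ∣ in ∣y∣ | trans (cong ∣_∣ eq) (trans (ℤₚ.abs-* (+ 4 * k) y)
      (cong (ℕ._* ∣ y ∣) (trans (ℤₚ.abs-* (+ 4) k) (cong (λ z → 4 ℕ.* ∣ z ∣) k≡))))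
    ... | zero | p = ℤₚ.∣i∣≡0⇒i≡0 (trans p (ℕₚ.*-zeroʳ (4 ℕ.* kn)))
    ... | suc n | p = ⊥-elim (ℕₚ.<⇒≱ x<28 (begin
      28                       ≤⟨ ℕₚ.*-monoʳ-≤ 4 7≤k ⟩
      4 ℕ.* kn                 ≤⟨ ℕₚ.m≤m*n (4 ℕ.* kn) (suc n) ⟩
      4 ℕ.* kn ℕ.* suc n       ≡⟨ p ⟨
      ∣ x ∣                    ∎))
      where open ℕₚ.≤-Reasoning

    k≢0 : k ≢ + 0
    k≢0 k≡0 = ℕₚ.n≮0 (subst (7 ℕ.≤_) (ℤₚ.+-injective (trans (sym k≡) k≡0)) 7≤k)

    k-cancel : ∀ {x y} → + 2 * (k * x) ≡ + 2 * (k * y) → x ≡ y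
    k-cancel {x} {y} eq = ℤₚ.*-cancelˡ-≡ k x y {{ℤ.≢-nonZero k≢0}} (halve eq)

    bit-≋ : ∀ {r r'} → + 2 * k * bit r ≋ + 2 * k * bit r' → r ≡ r'
    bit-≋ {false} {false} _ = refl
    bit-≋ {true}  {true}  _ = refl
    bit-≋ {false} {true}  (wit q eq) = ⊥-elim (2z≢1 (- q) (k-cancel (lem k q eq)))
      where lem : ∀ k q → + 2 * k * + 0 ≡ + 2 * k * + 1 + q * (+ 4 * k) → + 2 * (k * (+ 2 * (- q))) ≡ + 2 * (k * + 1)
            lem k q eq = by-hyp (+ 1) eq (solve (k ∷ q ∷ []))
    bit-≋ {true}  {false} (wit q eq) = ⊥-elim (2z≢1 q (k-cancel (lem k q eq)))
      where lem : ∀ k q → + 2 * k * + 1 ≡ + 2 * k * + 0 + q * (+ 4 * k) → + 2 * (k * (+ 2 * q)) ≡ + 2 * (k * + 1)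
            lem k q eq = by-hyp (- (+ 1)) eq (solve (k ∷ q ∷ []))

    -- Modulo 2k the bits disappear, so the difference of the (p, q) has a norm divisible by 4k,
    -- hence zero. What remains is that 2k is not 0 modulo 4k, which separates the bits.
    value-injective : ∀ p q r p' q' r' →
      ∣ norm (p - p') (q - q') ∣ ℕ.< 28 → (norm (p - p') (q - q') ≡ + 0 → p ≡ p' × q ≡ q') →
      value p q r ≋ value p' q' r' → p ≡ p' × q ≡ q' × r ≡ r'
    value-injective p q r p' q' r' small zero⇒≡ (wit t eq)
      with zero⇒≡ (small-multiple _ (norm-multiple (p - p') (q - q') (+ 2 * t - bit r + bit r')
             (diff p p' q q' (bit r) (bit r') h k t eq)) small)
      where
      diff : ∀ p p' q q' r r' h k t →
        p + + 2 * h * q + + 2 * k * r ≡ p' + + 2 * h * q' + + 2 * k * r' + t * (+ 4 * k) →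
        p - p' ≡ + 2 * (k * (+ 2 * t - r + r') - h * (q - q'))
      diff p p' q q' r r' h k t eq = by-hyp (+ 1) eq (solve (p ∷ p' ∷ q ∷ q' ∷ r ∷ r' ∷ h ∷ k ∷ t ∷ []))
    ... | refl , refl = refl , refl , bit-≋ (wit t (cancel p q (bit r) (bit r') h k t eq))
      where
      cancel : ∀ p q r r' h k t → p + + 2 * h * q + + 2 * k * r ≡ p + + 2 * h * q + + 2 * k * r' + t * (+ 4 * k) →
        + 2 * k * r ≡ + 2 * k * r' + t * (+ 4 * k)
      cancel p q r r' h k t eq = by-hyp (+ 1) eq (solve (p ∷ q ∷ r ∷ r' ∷ h ∷ k ∷ t ∷ []))

    eval-injective : ∀ x y → Near x y → eval x ≡ eval y → x ≡ y
    eval-injective (s , p , q , r) (s' , p' , q' , r') (small , zero⇒≡) eq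
      with pt-injective (trans (sym (eval≡ (s , p , q , r))) (trans eq (eval≡ (s' , p' , q' , r'))))
    ... | refl & p≋ with value-injective p q r p' q' r' small zero⇒≡ p≋
    ... | refl , refl , refl = refl

    -- Every neighbour of `eval x` is the image of one of the six points around x, and nearness
    -- identifies y with that point. This brings adjacency in the graph back to the cover.
    Adj-near : ∀ x y → All (Near y) (nbrs x) → Adj (eval x) (eval y) → y ∈ nbrs x
    Adj-near x y near xy with Adj-eval x xy
    ... | z , z∈ , eq = subst (_∈ nbrs x) (sym (eval-injective y z (All.lookup near z∈) eq)) z∈

    common-eval : ∀ x y → CommonNear x y → ∀ {z} → Adj (eval x) z → Adj (eval y) z →
      ∃ λ w → w ∈ nbrs x × w ∈ nbrs y × z ≡ eval w
    common-eval x y near {z} xz yz with Adj-eval x xz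
    ... | w , w∈ , refl = w , w∈ , Adj-near y w (All.lookup near w∈) yz , refl

    -- An automorphism fixing u₀ and reversing the rim at u₀ on one side reverses it on the other
    -- side as well: v₀-u₀-v₁ is the only 2-path v₁-u₀-w meeting different triangles in two 5-cycles.
    module _ (τ : Automorphism) (τu₀ : to τ (eval u₀) ≡ eval u₀) (τu₋₁ : to τ (eval u₋₁) ≡ eval u₁) where

      τ-adj : ∀ {x y x' y'} → to τ (eval x) ≡ x' → to τ (eval y) ≡ y' → y ∈ nbrs x → Adj x' y'
      τ-adj {x} refl refl y∈ = preserve τ _ _ (eval-Adj x y∈)

      τ-adj⁻¹ : ∀ {x y x' y'} → All (Near y) (nbrs x) → to τ (eval x) ≡ x' → to τ (eval y) ≡ y' → Adj x' y' → y ∈ nbrs x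
      τ-adj⁻¹ {x} {y} near refl refl xy = Adj-near x y near (reflect τ _ _ xy)

      τ-injective : ∀ x y → Near x y → to τ (eval x) ≡ to τ (eval y) → x ≡ y
      τ-injective x y near eq = eval-injective x y near
        (trans (sym (from-to τ _)) (trans (cong (from τ) eq) (from-to τ _)))

      -- `v₀` is a common neighbour of `u₀` and `u₋₁`, whose images `u₀` and `u₁` have only `v₁` in
      -- common.
      τv₀ : to τ (eval v₀) ≡ eval v₁
      τv₀ =
        let w , w∈u₀ , w∈u₁ , eq = common-eval u₀ u₁ (toWitness {a? = commonNear? u₀ u₁} _)
              (τ-adj {x = u₀} {y = v₀} τu₀ refl (toWitness {a? = v₀ ∈? nbrs u₀} _))
              (τ-adj {x = u₋₁} {y = v₀} τu₋₁ refl (toWitness {a? = v₀ ∈? nbrs u₋₁} _))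
        in trans eq (cong eval (All.lookup common-u₀-u₁ w∈u₀ w∈u₁))

      -- The 5-cycle u₀, v₀, x, y, v₁ is carried to u₀, v₁, x', y', w. Injectivity and reflection of
      -- adjacency keep x' away from `u₀` and its neighbours.
      image-pentagon : ∀ x y → x ∈ nbrs v₀ → y ∈ nbrs x → v₁ ∈ nbrs y → All (Near x) (nbrs u₀) →
        ¬ (x ∈ nbrs u₀) → Near x u₀ → x ≢ u₀ → ∀ w → w ∈ nbrs u₀ → to τ (eval v₁) ≡ eval w →
        ∃ λ x' → x' ∈ nbrs v₁ × to τ (eval x) ≡ eval x' × Pentagon w x'
      image-pentagon x y x∈ y∈ v₁∈ nearby x∉ near x≢ w w∈ τv₁
        with Adj-eval v₁ (τ-adj τv₀ refl x∈)
      ... | x' , x'∈ , τx with Adj-eval x' (τ-adj τx refl y∈)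
      ... | y' , y'∈ , τy = x' , x'∈ , τx , x'≢u₀ , x'∉ , any
        where
        x'≢u₀ : x' ≢ u₀
        x'≢u₀ refl = x≢ (τ-injective x u₀ near (trans τx (sym τu₀)))
        x'∉ : ¬ (x' ∈ nbrs u₀)
        x'∉ p = x∉ (τ-adj⁻¹ nearby τu₀ τx (eval-Adj u₀ p))
        y'∈w : y' ∈ nbrs w
        y'∈w = Adj-near w y' (All.lookup (All.lookup (All.lookup pentagon-near w∈) x'∈) y'∈)
          (Adj-sym (τ-adj τy τv₁ v₁∈))
        any : Any (_∈ nbrs w) (nbrs x')
        any = Any.map (λ { refl → y'∈w }) y'∈

      module _ (w : Sym) (w∈ : w ∈ nbrs u₀) (τv₁≡w : to τ (eval v₁) ≡ eval w) where

        pentagon₁ : ∃ λ x → x ∈ nbrs v₁ × to τ (eval a₁) ≡ eval x × Pentagon w x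
        pentagon₁ = image-pentagon a₁ b₁ (toWitness {a? = a₁ ∈? nbrs v₀} _) (toWitness {a? = b₁ ∈? nbrs a₁} _)
          (toWitness {a? = v₁ ∈? nbrs b₁} _) (toWitness {a? = All.all? (near? a₁) (nbrs u₀)} _)
          (toWitness {a? = ¬? (a₁ ∈? nbrs u₀)} _) (toWitness {a? = near? a₁ u₀} _) (λ ()) w w∈ τv₁≡w

        pentagon₂ : ∃ λ x → x ∈ nbrs v₁ × to τ (eval a₂) ≡ eval x × Pentagon w x
        pentagon₂ = image-pentagon a₂ b₂ (toWitness {a? = a₂ ∈? nbrs v₀} _) (toWitness {a? = b₂ ∈? nbrs a₂} _)
          (toWitness {a? = v₁ ∈? nbrs b₂} _) (toWitness {a? = All.all? (near? a₂) (nbrs u₀)} _)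
          (toWitness {a? = ¬? (a₂ ∈? nbrs u₀)} _) (toWitness {a? = near? a₂ u₀} _) (λ ()) w w∈ τv₁≡w

        a₁≢a₂ : ∀ {x y} → to τ (eval a₁) ≡ eval x → to τ (eval a₂) ≡ eval y → x ≢ y
        a₁≢a₂ τa₁ τa₂ refl = toWitness {a? = ¬? (a₁ ≟ a₂)} _
          (τ-injective a₁ a₂ (toWitness {a? = near? a₁ a₂} _) (trans τa₁ (sym τa₂)))

        w≢v₁ : w ≢ v₁
        w≢v₁ refl = toWitness {a? = ¬? (v₁ ≟ v₀)} _
          (τ-injective v₁ v₀ (toWitness {a? = near? v₁ v₀} _) (trans τv₁≡w (sym τv₀)))

        -- In the cover `v₀` and `v₁` are not adjacent, so neither are their images.
        w∉v₁ : ¬ (w ∈ nbrs v₁)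
        w∉v₁ p = toWitness {a? = ¬? (v₁ ∈? nbrs v₀)} _
          (τ-adj⁻¹ {x = v₀} {y = v₁} (toWitness {a? = All.all? (near? v₁) (nbrs v₀)} _) τv₀ τv₁≡w (eval-Adj v₁ p))

        τv₁≡v₀ : w ≡ v₀
        τv₁≡v₀ =
          let x , x∈ , τa₁ , px = pentagon₁
              y , y∈ , τa₂ , py = pentagon₂
          in All.lookup (All.lookup (All.lookup two-pentagons w∈) x∈) y∈ px py (a₁≢a₂ τa₁ τa₂) w∉v₁ w≢v₁

      τv₁ : to τ (eval v₁) ≡ eval v₀
      τv₁ =
        let w , w∈ , eq = Adj-eval u₀ (τ-adj {x = u₀} {y = v₁} τu₀ refl (toWitness {a? = v₁ ∈? nbrs u₀} _))
        in trans eq (cong eval (τv₁≡v₀ w w∈ eq))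

      -- `u₁` completes the triangle on `u₀` and `v₁`; their images `u₀` and `v₀` lie in a triangle
      -- with `u₋₁` only.
      τu₁ : to τ (eval u₁) ≡ eval u₋₁
      τu₁ =
        let w , w∈u₀ , w∈v₀ , eq = common-eval u₀ v₀ (toWitness {a? = commonNear? u₀ v₀} _)
              (τ-adj {x = u₀} {y = u₁} τu₀ refl (toWitness {a? = u₁ ∈? nbrs u₀} _))
              (τ-adj {x = v₁} {y = u₁} τv₁ refl (toWitness {a? = u₁ ∈? nbrs v₁} _))
        in trans eq (cong eval (All.lookup common-u₀-v₀ w∈u₀ w∈v₀))

    -- No automorphism reverses a rim edge.

    eval-U : ∀ z → eval (u , z , + 0 , false) ≡ U z
    eval-U z = trans (eval≡ (u , z , + 0 , false)) (U≡ (mod _ _ (+ 0) (lem z h k)))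
      where lem : ∀ z h k → z + + 2 * h * + 0 + + 2 * k * + 0 ≡ z + + 0 * (+ 4 * k)
            lem = solve-∀

    eval-W : ∀ z → eval (v , z , + 0 , false) ≡ W z
    eval-W z = trans (eval≡ (v , z , + 0 , false)) (W≡ (mod _ _ (+ 0) (lem z h k)))
      where lem : ∀ z h k → z + + 2 * h * + 0 + + 2 * k * + 0 ≡ z + + 0 * (+ 4 * k)
            lem = solve-∀

    no-reversal : (σ : Automorphism) → to σ (U (+ 0)) ≡ U (+ 1) → to σ (U (+ 1)) ≡ U (+ 0) → ⊥
    -- The point (v, 3, 1, true) is v_{2-b}, because 2 - b = 3 + 2h - 2k ≡ 3 + 2h + 2k (mod 4k).
    no-reversal σ σ0 σ1 = toWitness {a? = ¬? ((v , + 3 , + 1 , true) ∈? nbrs u₁)} _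
        (Adj-near u₁ (v , + 3 , + 1 , true) (toWitness {a? = All.all? (near? (v , + 3 , + 1 , true)) (nbrs u₁)} _) edge)
      where
      -- Conjugates σ by rotations so that the pair (u_i , u_{i+1}), sent to (u_{1-i} , u_{-i}), becomes (u₋₁ , u₀).
      local : ℤ → Automorphism
      local i = rotation i ∙ (σ ∙ rotation (i + + 1))

      at : ∀ i x {y} → to σ (U (x + (i + + 1))) ≡ y → to (local i) (U x) ≡ rot i y
      at i x refl = cong (λ z → rot i (to σ z)) (rot-U (i + + 1) x)

      Reflected : ℤ → Set
      Reflected i = to σ (U i) ≡ U (+ 1 - i) × to σ (U (i + + 1)) ≡ U (- i)

      module _ (i : ℤ) (σi : Reflected i) where
        loc₀ : to (local i) (eval u₀) ≡ eval u₀
        loc₀ = trans (cong (to (local i)) (eval-U (+ 0))) (trans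
          (at i (+ 0) (trans (cong (λ z → to σ (U z)) (ℤₚ.+-identityˡ (i + + 1))) (proj₂ σi)))
          (trans (rot-U i (- i)) (trans (cong U (ℤₚ.+-inverseˡ i)) (sym (eval-U (+ 0))))))

        loc₋₁ : to (local i) (eval u₋₁) ≡ eval u₁
        loc₋₁ = trans (cong (to (local i)) (eval-U -[1+ 0 ])) (trans
          (at i -[1+ 0 ] (trans (cong (λ z → to σ (U z)) (lem i)) (proj₁ σi)))
          (trans (rot-U i (+ 1 - i)) (trans (cong U (lem' i)) (sym (eval-U (+ 1))))))
          where
          lem : ∀ i → - (+ 1) + (i + + 1) ≡ i
          lem = solve-∀
          lem' : ∀ i → + 1 - i + i ≡ + 1
          lem' = solve-∀

        unrot : ∀ {x} y → rot i x ≡ y → x ≡ rot (- i) y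
        unrot y refl = sym (from-to (rotation i) _)

        next-U : to σ (U (+ 1 + (i + + 1))) ≡ U (- (i + + 1))
        next-U = trans (unrot (U -[1+ 0 ]) (trans (sym (at i (+ 1) refl)) (trans (cong (to (local i)) (sym (eval-U (+ 1))))
          (trans (τu₁ (local i) loc₀ loc₋₁) (eval-U -[1+ 0 ]))))) (trans (rot-U (- i) -[1+ 0 ]) (cong U (lem i)))
          where
          lem : ∀ i → - (+ 1) + - i ≡ - (i + + 1)
          lem = solve-∀

        next-W : to σ (W (i + + 1)) ≡ W (+ 1 - i)
        next-W = trans (unrot (W (+ 1)) (trans (cong (λ z → rot i (to σ z))
            (trans (cong W (sym (ℤₚ.+-identityˡ (i + + 1)))) (sym (rot-W (i + + 1) (+ 0)))))
            (trans (cong (to (local i)) (sym (eval-W (+ 0)))) (trans (τv₀ (local i) loc₀ loc₋₁) (eval-W (+ 1))))))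
          (rot-W (- i) (+ 1))

      -- Each reversed rim edge forces the next one through the local result, so the reversal
      -- spreads round the whole rim.
      reflected : ∀ n → Reflected (+ n)
      reflected zero = σ0 , σ1
      reflected (suc n) = trans (cong (λ z → to σ (U z)) (ℤₚ.+-comm (+ 1) (+ n)))
          (trans (proj₂ (reflected n)) (cong U (lem (+ n)))) ,
        trans (cong (λ z → to σ (U z)) (lem' (+ n)))
          (trans (next-U (+ n) (reflected n)) (cong (λ z → U (- z)) (ℤₚ.+-comm (+ n) (+ 1))))
        where
        lem : ∀ n → - n ≡ + 1 - (+ 1 + n)
        lem = solve-∀
        lem' : ∀ n → + 1 + n + + 1 ≡ + 1 + (n + + 1)
        lem' = solve-∀

      -- By reflected, the spoke u₀ v_b is mapped to u₁ v_{2-b}, which is not an edge.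
      spoke-image : to σ (R ω (U (+ 0))) ≡ eval (v , + 3 , + 1 , true)
      spoke-image = begin
        to σ (R ω (U (+ 0)))                   ≡⟨ cong (to σ) (R-pt ω (u , + 0)) ⟩
        -- `reflected` speaks of natural indices; i = b + (n - 1) is one with i + 1 ≡ b (mod n).
        to σ (W (+ 0 + (+ 2 * k - + 2 * h - + 1)))  ≡⟨ cong (to σ) (W≡ (mod _ _ (- (+ 1)) (source (+ bn) (+ n') k h b≡ N≡4k))) ⟩
        to σ (W (+ (bn ℕ.+ n') + + 1))         ≡⟨ next-W (+ (bn ℕ.+ n')) (reflected (bn ℕ.+ n')) ⟩
        W (+ 1 - + (bn ℕ.+ n'))                ≡⟨ W≡ (mod _ _ (- (+ 2)) (target (+ bn) (+ n') k h b≡ N≡4k)) ⟩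
        W (value (+ 3) (+ 1) true)             ≡⟨ eval≡ (v , + 3 , + 1 , true) ⟨
        eval (v , + 3 , + 1 , true)            ∎
        where
        open ≡-Reasoning
        source : ∀ b n k h → b ≡ + 2 * k - + 2 * h - + 1 → + 1 + n ≡ + 4 * k →
          + 0 + (+ 2 * k - + 2 * h - + 1) ≡ b + n + + 1 + - (+ 1) * (+ 4 * k)
        source b n k h refl eq = by-hyp (- (+ 1)) eq (solve (n ∷ k ∷ h ∷ []))
        target : ∀ b n k h → b ≡ + 2 * k - + 2 * h - + 1 → + 1 + n ≡ + 4 * k →
          + 1 - (b + n) ≡ + 3 + + 2 * h * + 1 + + 2 * k * + 1 + - (+ 2) * (+ 4 * k)
        target b n k h refl eq = by-hyp (- (+ 1)) eq (solve (n ∷ k ∷ h ∷ []))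

      edge : Adj (eval u₁) (eval (v , + 3 , + 1 , true))
      edge = subst₂ Adj (trans σ0 (sym (eval-U (+ 1)))) spoke-image (preserve σ _ _ (D⇒Adj {U (+ 0)} (ω , refl)))

    -- Half-arc-transitivity and the induced orientations.

    arc-transitive-on-D : ∀ {x y x' y'} → D x y → D x' y' → Σ Automorphism λ σ → to σ x ≡ x' × to σ y ≡ y'
    arc-transitive-on-D d d' with arc-transport d | arc-transport d'
    ... | σ , refl , refl | τ , refl , refl =
      τ ∙ σ ⁻¹ , cong (to τ) (from-to σ _) , cong (to τ) (from-to σ _)

    rim : ∀ x → D (U x) (U (x + + 1))
    rim x = 𝟙 , sym (R-pt 𝟙 (u , x))

    rim-Adj : ∀ x → Adj (U x) (U (x + + 1))
    rim-Adj x = D⇒Adj {U x} (rim x)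

    halfArcTransitive : HalfArcTransitive Adj
    halfArcTransitive = vertexTransitive , edgeTransitive , ¬arcTransitive
      where
      vertexTransitive : VertexTransitive Adj
      vertexTransitive x y with vertex-transport x | vertex-transport y
      ... | σ , refl , _ | τ , refl , _ = τ ∙ σ ⁻¹ , cong (to τ) (from-to σ _)

      edgeTransitive : EdgeTransitive Adj
      edgeTransitive x y x' y' xy xy' with Adj⇒D xy | Adj⇒D xy'
      ... | inj₁ d | inj₁ d' = let σ , p , q = arc-transitive-on-D d d' in σ , inj₁ (p , q)
      ... | inj₁ d | inj₂ d' = let σ , p , q = arc-transitive-on-D d d' in σ , inj₂ (p , q)
      ... | inj₂ d | inj₁ d' = let σ , p , q = arc-transitive-on-D d d' in σ , inj₂ (q , p)
      ... | inj₂ d | inj₂ d' = let σ , p , q = arc-transitive-on-D d d' in σ , inj₁ (q , p)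

      ¬arcTransitive : ¬ ArcTransitive Adj
      ¬arcTransitive arc with arc (U (+ 0)) (U (+ 1)) (U (+ 1)) (U (+ 0)) (rim-Adj (+ 0)) (Adj-sym {U (+ 0)} {U (+ 1)} (rim-Adj (+ 0)))
      ... | σ , σ0 , σ1 = no-reversal σ σ0 σ1

    preserves-D : (σ : Automorphism) → ∀ {x y} → D x y → D (to σ x) (to σ y) ⊎ D (to σ y) (to σ x)
    preserves-D σ d = Adj⇒D (preserve σ _ _ (D⇒Adj d))

    -- Transporting u₀u₁ to both arcs and conjugating accordingly turns σ into an automorphism that
    -- reverses u₀u₁.
    no-arc-reversal : ∀ {x y x' y'} → D x y → D y' x' → (σ : Automorphism) → to σ x ≡ x' → to σ y ≡ y' → ⊥
    no-arc-reversal d d' σ refl refl with arc-transport d | arc-transport d'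
    ... | α , refl , refl | β , β0 , β1 = no-reversal (β ⁻¹ ∙ (σ ∙ α))
      (trans (cong (from β) (sym β1)) (from-to β _)) (trans (cong (from β) (sym β0)) (from-to β _))

    Oriented⇒D : ∀ {x₀ y₀ x y} → D x₀ y₀ → Oriented Adj x₀ y₀ x y → D x y
    Oriented⇒D d (σ , refl , refl) with preserves-D σ d
    ... | inj₁ d' = d'
    ... | inj₂ d' = ⊥-elim (no-arc-reversal d d' σ refl refl)

    Oriented⇒Dᵒᵖ : ∀ {x₀ y₀ x y} → D y₀ x₀ → Oriented Adj x₀ y₀ x y → D y x
    Oriented⇒Dᵒᵖ d (σ , p , q) = Oriented⇒D d (σ , q , p)

    -- Alternating walks and the classes they join.

    Alternation : (V → V → Set) → V → V → V → Set
    Alternation O c d e = (O c d × O e d) ⊎ (O d c × O d e)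

    AltWalk-map : ∀ {O O'} → (∀ {c d e} → Alternation O c d e → Alternation O' c d e) →
      ∀ {a b c d} → AltWalk Adj O a b c d → AltWalk Adj O' a b c d
    AltWalk-map f (single ab) = single ab
    AltWalk-map f (step w de alt) = step (AltWalk-map f w) de (f alt)

    Reachable-map : ∀ {O O'} → (∀ {c d e} → Alternation O c d e → Alternation O' c d e) →
      ∀ e e' → Reachable Adj O e e' → Reachable Adj O' e e'
    Reachable-map f _ _ (a , b , c , d , p , q , w) = a , b , c , d , p , q , AltWalk-map f w

    -- The induced orientation is `D` or its opposite, and reversing the orientation only exchanges
    -- the two forms of alternation.
    Oriented-Alternation : ∀ {x₀ y₀} → Adj x₀ y₀ → ∀ {c d e} →
      (Alternation D c d e → Alternation (Oriented Adj x₀ y₀) c d e) ×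
      (Alternation (Oriented Adj x₀ y₀) c d e → Alternation D c d e)
    Oriented-Alternation adj with Adj⇒D adj
    ... | inj₁ d =
      [ (λ (p , q) → inj₁ (arc-transitive-on-D d p , arc-transitive-on-D d q)) ,
        (λ (p , q) → inj₂ (arc-transitive-on-D d p , arc-transitive-on-D d q)) ]′ ,
      [ (λ (p , q) → inj₁ (Oriented⇒D d p , Oriented⇒D d q)) ,
        (λ (p , q) → inj₂ (Oriented⇒D d p , Oriented⇒D d q)) ]′
    ... | inj₂ d =
      [ (λ (p , q) → inj₂ (op p , op q)) , (λ (p , q) → inj₁ (op p , op q)) ]′ ,
      [ (λ (p , q) → inj₂ (Oriented⇒Dᵒᵖ d p , Oriented⇒Dᵒᵖ d q)) ,
        (λ (p , q) → inj₁ (Oriented⇒Dᵒᵖ d p , Oriented⇒Dᵒᵖ d q)) ]′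
      where
      op : ∀ {x y} → D x y → Oriented Adj _ _ y x
      op p = let σ , α , β = arc-transitive-on-D d p in σ , β , α

    -- Alternating walks may turn back along an edge, so the direction in which their last edge
    -- is traversed is immaterial.
    Tail : V → V → V → Set
    Tail a b x = ∀ {y} → D x y → AltWalk Adj D a b x y

    tail-start : ∀ {a b} → D a b → Tail a b a
    -- The walk is a, b, a, y.
    tail-start ab d = step (step (single (D⇒Adj ab)) (Adj-sym (D⇒Adj ab)) (inj₁ (ab , ab))) (D⇒Adj d) (inj₂ (ab , d))

    tail-step : ∀ {a b x y z} → Tail a b x → D x y → D z y → Tail a b z
    tail-step t xy zy d = step (step (t xy) (Adj-sym (D⇒Adj zy)) (inj₁ (xy , zy))) (D⇒Adj d) (inj₂ (zy , d))

    -- The edges with tail U x are joined to those with tail W (x + 2), and these to those with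
    -- tail U (x + 2k + 3).  As 2k (2k + 3) ≡ 2k (mod 4k), iteration gives the translations by 2k and 3.
    module Closure {P : V → Set} (P-step : ∀ {x y z} → P x → D x y → D z y → P z) where

      U⇒W : ∀ x → P (U x) → P (W (x + + 2))
      U⇒W x p = P-step p (𝟙 , refl) (ω , trans (R-pt 𝟙 (u , x))
        (trans (U≡ (≡⇒≋ (lem x))) (sym (R-pt ω (v , x + + 2)))))
        where lem : ∀ x → x + + 1 ≡ x + + 2 + - (+ 1)
              lem = solve-∀

      W⇒U : ∀ x → P (W x) → P (U (x + (+ 2 * k + + 1)))
      W⇒U x p = P-step p (𝟙 , refl) (ω̄ , trans (R-pt 𝟙 (v , x)) (sym (R-pt ω̄ (u , x + (+ 2 * k + + 1)))))

      cast : ∀ {x y} → x ≋ y → P (U x) → P (U y)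
      cast x≋y = subst P (U≡ x≋y)

      -- A possibly negative j is replaced by its residue modulo 4k, a natural number on which one
      -- can induct; this changes j s by a multiple of 4k.
      iterate : ∀ s → (∀ x → P (U x) → P (U (x + s))) → ∀ j x → P (U x) → P (U (x + j * s))
      iterate s f j x p = cast (wrap (toℕ-π j)) (go (toℕ (π j)))
        where
        wrap : ∀ {i j} → i ≋ j → x + i * s ≋ x + j * s
        wrap {j = j} (wit q refl) = wit (q * s) (lem x s j q k)
          where lem : ∀ x s j q k → x + (j + q * (+ 4 * k)) * s ≡ x + j * s + q * s * (+ 4 * k)
                lem = solve-∀
        go : ∀ n → P (U (x + + n * s))
        go zero = cast (≡⇒≋ (lem x s)) p
          where lem : ∀ x s → x ≡ x + + 0 * s
                lem = solve-∀
        go (suc n) = cast (≡⇒≋ (lem x s (+ n))) (f _ (go n))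
          where lem : ∀ x s n → x + n * s + s ≡ x + (+ 1 + n) * s
                lem = solve-∀

      +2k+3 : ∀ x → P (U x) → P (U (x + (+ 2 * k + + 3)))
      +2k+3 x p = cast (≡⇒≋ (lem x k)) (W⇒U _ (U⇒W x p))
        where lem : ∀ x k → x + + 2 + (+ 2 * k + + 1) ≡ x + (+ 2 * k + + 3)
              lem = solve-∀

      +2k : ∀ x → P (U x) → P (U (x + + 2 * k))
      +2k x p = cast (mod _ _ (k + + 1) (lem x k)) (iterate _ +2k+3 (+ 2 * k) x p)
        where lem : ∀ x k → x + + 2 * k * (+ 2 * k + + 3) ≡ x + + 2 * k + (k + + 1) * (+ 4 * k)
              lem = solve-∀

      +3 : ∀ x → P (U x) → P (U (x + + 3))
      +3 x p = cast (mod _ _ (+ 1) (lem x k)) (+2k _ (+2k+3 x p))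
        where lem : ∀ x k → x + (+ 2 * k + + 3) + + 2 * k ≡ x + + 3 + + 1 * (+ 4 * k)
              lem = solve-∀

      +3* : ∀ j x → P (U x) → P (U (x + j * + 3))
      +3* = iterate (+ 3) +3

    orient : ((x , y , _) : Edge Adj) → ∃ λ a → ∃ λ b → SameEnds Adj x y a b × D a b
    orient (x , y , xy) with Adj⇒D xy
    ... | inj₁ d = x , y , inj₁ (refl , refl) , d
    ... | inj₂ d = y , x , inj₂ (refl , refl) , d

    module _ {P : V → Set} (P-step : ∀ {x y z} → P x → D x y → D z y → P z) where
      open Closure P-step

      unit-translation : (∃ λ t → + 2 * k ≡ t * + 3 + + 1) ⊎ (∃ λ t → + 2 * k ≡ t * + 3 + + 2) →
        ∀ x → P (U x) → P (U (x + + 1))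
      unit-translation (inj₁ (t , eq)) x p = cast (≡⇒≋ (lem x k t eq)) (+3* (- t) _ (+2k x p))
        where lem : ∀ x k t → + 2 * k ≡ t * + 3 + + 1 → x + + 2 * k + - t * + 3 ≡ x + + 1
              lem x k t eq = by-hyp (+ 1) eq (solve (x ∷ k ∷ t ∷ []))
      -- Here 2k + 3 (t + 1) = 4k + 1.
      unit-translation (inj₂ (t , eq)) x p = cast (mod _ _ (+ 1) (lem x k t eq)) (+3* (t + + 1) _ (+2k x p))
        where lem : ∀ x k t → + 2 * k ≡ t * + 3 + + 2 → x + + 2 * k + (t + + 1) * + 3 ≡ x + + 1 + + 1 * (+ 4 * k)
              lem x k t eq = by-hyp (- (+ 1)) eq (solve (x ∷ k ∷ t ∷ []))

      connected : (∀ x → P (U x) → P (U (x + + 1))) → ∀ x y → P x → P y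
      connected +1 x y p = to-U y (from-U x p)
        where
        rims : ∀ i j → P (U i) → P (U j)
        rims i j p = cast (≡⇒≋ (lem i j)) (iterate (+ 1) +1 (j - i) i p)
          where lem : ∀ i j → i + (j - i) * + 1 ≡ j
                lem = solve-∀
        from-U : ∀ x → P x → P (U (+ 0))
        from-U (inj₁ i) p = rims _ (+ 0) (subst P (sym (pt-rep (inj₁ i))) p)
        from-U (inj₂ i) p = rims _ (+ 0) (W⇒U _ (subst P (sym (pt-rep (inj₂ i))) p))
        to-U : ∀ y → P (U (+ 0)) → P y
        to-U (inj₁ i) p = subst P (pt-rep (inj₁ i)) (rims (+ 0) _ p)
        to-U (inj₂ i) p = subst P (trans (W≡ (≡⇒≋ (lem (+ toℕ i)))) (pt-rep (inj₂ i)))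
            (U⇒W (+ toℕ i - + 2) (rims (+ 0) _ p))
          where lem : ∀ i → i - + 2 + + 2 ≡ i
                lem = solve-∀

    residue : ∀ x → (∃ λ q → x ≡ + 0 + q * + 3) ⊎ (∃ λ q → x ≡ + 1 + q * + 3) ⊎ (∃ λ q → x ≡ + 2 + q * + 3)
    residue x with x %ℕ 3 | n%ℕd<d x 3 | a≡a%ℕn+[a/ℕn]*n x 3
    ... | 0 | _ | eq = inj₁ (x /ℕ 3 , eq)
    ... | 1 | _ | eq = inj₂ (inj₁ (x /ℕ 3 , eq))
    ... | 2 | _ | eq = inj₂ (inj₂ (x /ℕ 3 , eq))
    ... | suc (suc (suc _)) | s≤s (s≤s (s≤s ())) | _

    Tail-classes : V → Set
    Tail-classes x = Tail (U (+ 0)) (U (+ 1)) x ⊎ Tail (U (+ 1)) (U (+ 2)) x ⊎ Tail (U (+ 2)) (U (+ 3)) x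

    tail-U : ∀ r q → Tail (U r) (U (r + + 1)) (U (r + q * + 3))
    tail-U r q = Closure.+3* {P = Tail (U r) (U (r + + 1))} tail-step q r (tail-start (rim r))

    tail-W : ∀ r q → Tail (U r) (U (r + + 1)) (W (r + q * + 3 + + 2))
    tail-W r q = Closure.U⇒W {P = Tail (U r) (U (r + + 1))} tail-step _ (tail-U r q)

    tail-classes : ∀ x → Tail-classes x
    tail-classes (inj₁ i) with residue (+ toℕ i)
    ... | inj₁ (q , eq)        = inj₁ (subst (Tail _ _) (trans (cong U (sym eq)) (pt-rep (inj₁ i))) (tail-U (+ 0) q))
    ... | inj₂ (inj₁ (q , eq)) = inj₂ (inj₁ (subst (Tail _ _) (trans (cong U (sym eq)) (pt-rep (inj₁ i))) (tail-U (+ 1) q)))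
    ... | inj₂ (inj₂ (q , eq)) = inj₂ (inj₂ (subst (Tail _ _) (trans (cong U (sym eq)) (pt-rep (inj₁ i))) (tail-U (+ 2) q)))
    -- By `U⇒W`, the v with index x + 2 falls into the class of the u with index x.
    tail-classes (inj₂ i) with residue (+ toℕ i - + 2)
    ... | r = go r
      where
      shape : ∀ c q → + toℕ i - + 2 ≡ c + q * + 3 → W (c + q * + 3 + + 2) ≡ inj₂ i
      shape c q eq = trans (cong W (trans (cong (λ z → z + + 2) (sym eq)) (lem (+ toℕ i)))) (pt-rep (inj₂ i))
        where lem : ∀ i → i - + 2 + + 2 ≡ i
              lem = solve-∀
      go : _ → Tail-classes (inj₂ i)
      go (inj₁ (q , eq))        = inj₁ (subst (Tail _ _) (shape (+ 0) q eq) (tail-W (+ 0) q))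
      go (inj₂ (inj₁ (q , eq))) = inj₂ (inj₁ (subst (Tail _ _) (shape (+ 1) q eq) (tail-W (+ 1) q)))
      go (inj₂ (inj₂ (q , eq))) = inj₂ (inj₂ (subst (Tail _ _) (shape (+ 2) q eq) (tail-W (+ 2) q)))

    tail-reachable : ∀ {a b} (ab : Adj a b) → ∀ f → let (c , _ , _) = orient f in Tail a b c →
      Reachable Adj D (a , b , ab) f
    tail-reachable ab f t = let c , d , same , cd = orient f in
      _ , _ , c , d , inj₁ (refl , refl) , same , t cd

    universal : (∃ λ t → + 2 * k ≡ t * + 3 + + 1) ⊎ (∃ λ t → + 2 * k ≡ t * + 3 + + 2) → UniversalReachability Adj D
    universal 2k e f =
      let a , b , same , ab = orient e
          c , d , same' , cd = orient f
      in a , b , c , d , same , same' ,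
         connected {P = Tail a b} tail-step (unit-translation {P = Tail a b} tail-step 2k) a c (tail-start ab) cd

    -- The 3-colouring that separates three alternets.

    infix 4 _≡₃_
    record _≡₃_ (x y : ℤ) : Set where
      constructor wit₃
      field
        quot₃  : ℤ
        equal₃ : x ≡ y + quot₃ * + 3

    ≡₃-sym : ∀ {x y} → x ≡₃ y → y ≡₃ x
    ≡₃-sym {x} {y} (wit₃ q refl) = wit₃ (- q) (lem y q)
      where lem : ∀ y q → y ≡ y + q * + 3 + - q * + 3
            lem = solve-∀

    ≡₃-trans : ∀ {x y z} → x ≡₃ y → y ≡₃ z → x ≡₃ z
    ≡₃-trans {z = z} (wit₃ q refl) (wit₃ r refl) = wit₃ (q + r) (lem z q r)
      where lem : ∀ z q r → z + r * + 3 + q * + 3 ≡ z + (q + r) * + 3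
            lem = solve-∀

    ≡₃-+ : ∀ {x y x' y'} → x ≡₃ y → x' ≡₃ y' → x + x' ≡₃ y + y'
    ≡₃-+ {y = y} {y' = y'} (wit₃ q refl) (wit₃ r refl) = wit₃ (q + r) (lem y y' q r)
      where lem : ∀ y y' q r → y + q * + 3 + (y' + r * + 3) ≡ y + y' + (q + r) * + 3
            lem = solve-∀

    ≢₃ : ∀ {x y} → ¬ (3 ℕ∣.∣ ∣ x - y ∣) → ¬ (x ≡₃ y)
    ≢₃ {x} {y} ∤ (wit₃ q refl) = ∤ (ℕ∣.divides ∣ q ∣ (trans (cong ∣_∣ (lem y q)) (ℤₚ.abs-* q (+ 3))))
      where lem : ∀ y q → y + q * + 3 - y ≡ q * + 3
            lem = solve-∀

    module DivisibleBy3 (t s : ℤ) (k≡3t : k ≡ t * + 3) (h≡1 : h ≡ + 1 + s * + 3) where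

      ≋⇒≡₃ : ∀ {x y} → x ≋ y → x ≡₃ y
      ≋⇒≡₃ {y = y} (wit q refl) = wit₃ (q * + 4 * t) (lem y q k t k≡3t)
        where lem : ∀ y q k t → k ≡ t * + 3 → y + q * (+ 4 * k) ≡ y + q * + 4 * t * + 3
              lem y q k t refl = solve (y ∷ q ∷ t ∷ [])

      colour : V → ℤ
      colour (inj₁ i) = + toℕ i
      colour (inj₂ i) = + toℕ i + + 1

      colour-U : ∀ x → colour (U x) ≡₃ x
      colour-U x = ≋⇒≡₃ (toℕ-π x)

      colour-W : ∀ x → colour (W x) ≡₃ x + + 1
      colour-W x = ≋⇒≡₃ (≋-+ (+ 1) (toℕ-π x))

      colour-D : ∀ {x y} → D x y → colour y ≡₃ colour x + + 1
      colour-D {inj₁ i} (𝟙 , refl) = colour-U (+ toℕ i + + 1)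
      colour-D {inj₁ i} (ω̄ , refl) = colour-W (+ toℕ i)
      colour-D {inj₁ i} (ω , refl) = ≡₃-trans (colour-W (+ toℕ i + (+ 2 * k - + 2 * h - + 1)))
        (wit₃ (+ 2 * t - + 2 * s - + 1) (lem (+ toℕ i) k h t s k≡3t h≡1))
        where lem : ∀ i k h t s → k ≡ t * + 3 → h ≡ + 1 + s * + 3 →
                i + (+ 2 * k - + 2 * h - + 1) + + 1 ≡ i + + 1 + (+ 2 * t - + 2 * s - + 1) * + 3
              lem i k h t s refl refl = solve (i ∷ t ∷ s ∷ [])
      colour-D {inj₂ i} (𝟙 , refl) = ≡₃-trans (colour-W (+ toℕ i + (+ 2 * k + + 1)))
        (wit₃ (+ 2 * t) (lem (+ toℕ i) k t k≡3t))
        where lem : ∀ i k t → k ≡ t * + 3 → i + (+ 2 * k + + 1) + + 1 ≡ i + + 1 + + 1 + + 2 * t * + 3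
              lem i k t refl = solve (i ∷ t ∷ [])
      colour-D {inj₂ i} (ω̄ , refl) = ≡₃-trans (colour-U (+ toℕ i + + 2 * h))
        (wit₃ (+ 2 * s) (lem (+ toℕ i) h s h≡1))
        where lem : ∀ i h s → h ≡ + 1 + s * + 3 → i + + 2 * h ≡ i + + 1 + + 1 + + 2 * s * + 3
              lem i h s refl = solve (i ∷ s ∷ [])
      colour-D {inj₂ i} (ω , refl) = ≡₃-trans (colour-U (+ toℕ i + - (+ 1)))
        (wit₃ (- (+ 1)) (lem (+ toℕ i)))
        where lem : ∀ i → i + - (+ 1) ≡ i + + 1 + + 1 + - (+ 1) * + 3
              lem = solve-∀

      same-successor : ∀ {c d e} → D c d → D e d → colour c ≡₃ colour e
      same-successor {c} {d} {e} p q with ≡₃-trans (≡₃-sym (colour-D p)) (colour-D q)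
      ... | wit₃ r eq = wit₃ r (lem (colour c) (colour e) r eq)
        where lem : ∀ c e r → c + + 1 ≡ e + + 1 + r * + 3 → c ≡ e + r * + 3
              lem c e r eq = by-hyp (+ 1) eq (solve (c ∷ e ∷ r ∷ []))

      ends-sum : V → V → ℤ
      ends-sum x y = colour x + colour y

      ends-sum-sym : ∀ x y → ends-sum x y ≡₃ ends-sum y x
      ends-sum-sym x y = wit₃ (+ 0) (lem (colour x) (colour y))
        where lem : ∀ x y → x + y ≡ y + x + + 0 * + 3
              lem = solve-∀

      ≡₃-refl : ∀ {x} → x ≡₃ x
      ≡₃-refl {x} = wit₃ (+ 0) (lem x)
        where lem : ∀ x → x ≡ x + + 0 * + 3
              lem = solve-∀

      -- An arc of tail colour c has end colours c and c + 1, so their sum modulo 3 recovers c.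
      AltWalk-ends-sum : ∀ {a b c d} → AltWalk Adj D a b c d → ends-sum a b ≡₃ ends-sum c d
      AltWalk-ends-sum (single _) = ≡₃-refl
      AltWalk-ends-sum (step {c = c} {d} {e} w _ (inj₁ (cd , ed))) =
        ≡₃-trans (AltWalk-ends-sum w) (≡₃-trans (≡₃-+ (same-successor cd ed) (≡₃-refl {colour d})) (ends-sum-sym e d))
      AltWalk-ends-sum (step {c = c} {d} {e} w _ (inj₂ (dc , de))) =
        ≡₃-trans (AltWalk-ends-sum w) (≡₃-trans (ends-sum-sym c d)
          (≡₃-+ (≡₃-refl {colour d}) (≡₃-trans (colour-D dc) (≡₃-sym (colour-D de)))))

      SameEnds-sum : ∀ {x y a b} → SameEnds Adj x y a b → ends-sum x y ≡₃ ends-sum a b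
      SameEnds-sum (inj₁ (refl , refl)) = ≡₃-refl
      SameEnds-sum {x} {y} (inj₂ (refl , refl)) = ends-sum-sym x y

      Reachable-sum : ∀ e f → Reachable Adj D e f → ends-sum (proj₁ e) (proj₁ (proj₂ e)) ≡₃ ends-sum (proj₁ f) (proj₁ (proj₂ f))
      Reachable-sum _ _ (a , b , c , d , p , q , w) =
        ≡₃-trans (SameEnds-sum p) (≡₃-trans (AltWalk-ends-sum w) (≡₃-sym (SameEnds-sum q)))

      rim-edge : ℤ → Edge Adj
      rim-edge x = U x , U (x + + 1) , rim-Adj x

      rim-sum : ∀ x → ends-sum (U x) (U (x + + 1)) ≡₃ x + (x + + 1)
      rim-sum x = ≡₃-+ (colour-U x) (colour-U (x + + 1))

      separated : ∀ x y → ¬ (3 ℕ∣.∣ ∣ x + (x + + 1) - (y + (y + + 1)) ∣) → ¬ Reachable Adj D (rim-edge x) (rim-edge y)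
      separated x y ∤ r = ≢₃ ∤ (≡₃-trans (≡₃-sym (rim-sum x)) (≡₃-trans (Reachable-sum (rim-edge x) (rim-edge y) r) (rim-sum y)))

      three-alternets : ThreeAlternets Adj D
      three-alternets = rim-edge (+ 0) , rim-edge (+ 1) , rim-edge (+ 2) ,
        -- The end sums of the rim edges with tails x and y are 2x + 1 and 2y + 1, so they differ by
        -- 2 or by 4.
        ( separated (+ 0) (+ 1) (toWitness {a? = ¬? (3 ℕ∣.∣? 2)} _) , separated (+ 1) (+ 0) (toWitness {a? = ¬? (3 ℕ∣.∣? 2)} _)
        , separated (+ 0) (+ 2) (toWitness {a? = ¬? (3 ℕ∣.∣? 4)} _) , separated (+ 2) (+ 0) (toWitness {a? = ¬? (3 ℕ∣.∣? 4)} _)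
        , separated (+ 1) (+ 2) (toWitness {a? = ¬? (3 ℕ∣.∣? 2)} _) , separated (+ 2) (+ 1) (toWitness {a? = ¬? (3 ℕ∣.∣? 2)} _)
        ) , classify
        where
        classify : ∀ f → Reachable Adj D (rim-edge (+ 0)) f ⊎ Reachable Adj D (rim-edge (+ 1)) f ⊎ Reachable Adj D (rim-edge (+ 2)) f
        classify f with tail-classes (proj₁ (orient f))
        ... | inj₁ t        = inj₁ (tail-reachable (rim-Adj (+ 0)) f t)
        ... | inj₂ (inj₁ t) = inj₂ (inj₁ (tail-reachable (rim-Adj (+ 1)) f t))
        ... | inj₂ (inj₂ t) = inj₂ (inj₂ (tail-reachable (rim-Adj (+ 2)) f t))

    -- Residues of h and 2k modulo 3, and the passage from `D` to the induced orientations.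

    3∣k : Set
    3∣k = ∃ λ t → k ≡ t * + 3

    -- Modulo 3, h² + h + 1 vanishes only for h ≡ 1; at 0 and 2 it equals 1.
    h-residue : ∀ t → k ≡ t * + 3 → ∃ λ s → h ≡ + 1 + s * + 3
    h-residue t k≡3t with residue h
    ... | inj₁ (q , eq) = ⊥-elim (≢₃ {+ 1} {+ 0} (toWitness {a? = ¬? (3 ℕ∣.∣? 1)} _)
            (wit₃ (t * (+ 2 * e + + 1) - + 3 * (q * q) - q) (lem h k e t q eq k≡3t hh)))
      where lem : ∀ h k e t q → h ≡ + 0 + q * + 3 → k ≡ t * + 3 → h * h + h + + 1 ≡ k * (+ 2 * e + + 1) →
              + 1 ≡ + 0 + (t * (+ 2 * e + + 1) - + 3 * (q * q) - q) * + 3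
            lem h k e t q refl refl eq = by-hyp (+ 1) eq (solve (e ∷ t ∷ q ∷ []))
    ... | inj₂ (inj₁ s) = s
    ... | inj₂ (inj₂ (q , eq)) = ⊥-elim (≢₃ {+ 1} {+ 0} (toWitness {a? = ¬? (3 ℕ∣.∣? 1)} _)
            (wit₃ (t * (+ 2 * e + + 1) - + 3 * (q * q) - + 5 * q - + 2) (lem h k e t q eq k≡3t hh)))
      where lem : ∀ h k e t q → h ≡ + 2 + q * + 3 → k ≡ t * + 3 → h * h + h + + 1 ≡ k * (+ 2 * e + + 1) →
              + 1 ≡ + 0 + (t * (+ 2 * e + + 1) - + 3 * (q * q) - + 5 * q - + 2) * + 3
            lem h k e t q refl refl eq = by-hyp (+ 1) eq (solve (e ∷ t ∷ q ∷ []))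

    2k-residue : ¬ 3∣k → (∃ λ t → + 2 * k ≡ t * + 3 + + 1) ⊎ (∃ λ t → + 2 * k ≡ t * + 3 + + 2)
    2k-residue ∤k with residue (+ 2 * k)
    -- k = 3k - 2k.
    ... | inj₁ (q , eq) = ⊥-elim (∤k (k - q , lem k q eq))
      where lem : ∀ k q → + 2 * k ≡ + 0 + q * + 3 → k ≡ (k - q) * + 3
            lem k q eq = by-hyp (- (+ 1)) eq (solve (k ∷ q ∷ []))
    ... | inj₂ (inj₁ (q , eq)) = inj₁ (q , trans eq (ℤₚ.+-comm (+ 1) (q * + 3)))
    ... | inj₂ (inj₂ (q , eq)) = inj₂ (q , trans eq (ℤₚ.+-comm (+ 2) (q * + 3)))

    module _ {x₀ y₀} (x₀y₀ : Adj x₀ y₀) where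

      from-D : ∀ e f → Reachable Adj D e f → Reachable Adj (Oriented Adj x₀ y₀) e f
      from-D = Reachable-map (proj₁ (Oriented-Alternation x₀y₀))

      to-D : ∀ e f → Reachable Adj (Oriented Adj x₀ y₀) e f → Reachable Adj D e f
      to-D = Reachable-map (proj₂ (Oriented-Alternation x₀y₀))

      oriented-universal : ¬ 3∣k → UniversalReachability Adj (Oriented Adj x₀ y₀)
      oriented-universal ∤k e f = from-D e f (universal (2k-residue ∤k) e f)

      oriented-three-alternets : 3∣k → ThreeAlternets Adj (Oriented Adj x₀ y₀)
      oriented-three-alternets (t , k≡3t) =
        let s , h≡1 = h-residue t k≡3t
            e₁ , e₂ , e₃ , (n₁₂ , n₂₁ , n₁₃ , n₃₁ , n₂₃ , n₃₂) , classify = DivisibleBy3.three-alternets t s k≡3t h≡1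
        in e₁ , e₂ , e₃ ,
           ((λ r → n₁₂ (to-D e₁ e₂ r)) , (λ r → n₂₁ (to-D e₂ e₁ r)) , (λ r → n₁₃ (to-D e₁ e₃ r)) ,
            (λ r → n₃₁ (to-D e₃ e₁ r)) , (λ r → n₂₃ (to-D e₂ e₃ r)) , (λ r → n₃₂ (to-D e₃ e₂ r))) ,
           λ f → [ (λ r → inj₁ (from-D e₁ f r)) , [ (λ r → inj₂ (inj₁ (from-D e₂ f r))) , (λ r → inj₂ (inj₂ (from-D e₃ f r))) ]′ ]′ (classify f)

      oriented-not-universal : 3∣k → ¬ UniversalReachability Adj (Oriented Adj x₀ y₀)
      oriented-not-universal d universal =
        let e₁ , e₂ , _ , (n₁₂ , _) , _ = oriented-three-alternets d in n₁₂ (universal e₁ e₂)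

  -- From the hypotheses on b and m to the parameters k and h.

  six-too-small : ∀ b₀ → b₀ ℕ.≤ 3 → 1 < b₀ → ¬ (6 ∣ ((4 ℕ.* b₀ ∸ 1) ^ 2 ℕ.+ 3))
  six-too-small 1 _ (s≤s ())
  -- The numbers tested are b² + 3 for b = 7 and b = 11.
  six-too-small 2 _ _ = toWitness {a? = ¬? (6 ℕ∣.∣? 52)} _
  six-too-small 3 _ _ = toWitness {a? = ¬? (6 ℕ∣.∣? 124)} _
  six-too-small (suc (suc (suc (suc _)))) (s≤s (s≤s (s≤s ())))

  ten-too-small : ∀ b₀ → b₀ ℕ.≤ 5 → 1 < b₀ → ¬ (10 ∣ ((4 ℕ.* b₀ ∸ 1) ^ 2 ℕ.+ 3))
  ten-too-small 1 _ (s≤s ())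
  ten-too-small 2 _ _ = toWitness {a? = ¬? (10 ℕ∣.∣? 52)} _
  ten-too-small 3 _ _ = toWitness {a? = ¬? (10 ℕ∣.∣? 124)} _
  ten-too-small 4 _ _ = toWitness {a? = ¬? (10 ℕ∣.∣? 228)} _
  ten-too-small 5 _ _ = toWitness {a? = ¬? (10 ℕ∣.∣? 364)} _
  ten-too-small (suc (suc (suc (suc (suc (suc _)))))) (s≤s (s≤s (s≤s (s≤s (s≤s ())))))

  half-bound : ∀ b₀ c → 4 ℕ.* b₀ ∸ 1 < 4 ℕ.* c → b₀ ℕ.≤ c
  half-bound b₀ c lt = ℕₚ.*-cancelˡ-≤ 4 (ℕₚ.≤-trans (ℕₚ.m≤n+m∸n (4 ℕ.* b₀) 1) lt)

  -- The cases m = 6 and m = 10 are excluded by b < 2m.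
  lower-bound : ∀ b₀ m j → 1 < b₀ → 2 < m → m ∣ ((4 ℕ.* b₀ ∸ 1) ^ 2 ℕ.+ 3) → 4 ℕ.* b₀ ∸ 1 < 2 ℕ.* m →
    m ≡ 2 ℕ.+ j ℕ.* 4 → 7 ℕ.≤ 1 ℕ.+ j ℕ.* 2
  lower-bound b₀ m 0 _ 2<2 _ _ refl = ⊥-elim (ℕₚ.<-irrefl refl 2<2)
  lower-bound b₀ m 1 1<b₀ _ m∣ lt refl = ⊥-elim (six-too-small b₀ (half-bound b₀ 3 lt) 1<b₀ m∣)
  lower-bound b₀ m 2 1<b₀ _ m∣ lt refl = ⊥-elim (ten-too-small b₀ (half-bound b₀ 5 lt) 1<b₀ m∣)
  lower-bound b₀ m (suc (suc (suc j))) _ _ _ _ _ = ℕₚ.m≤m+n 7 (j ℕ.* 2)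

  -- With b = 4B - 1 and k = 2j + 1, the divisibility 2k ∣ b² + 3 says k i = 4B² - 2B + 1 for some i,
  -- which is odd because the right-hand side is.
  odd-cofactor : ∀ B j q b → b ≡ + 4 * B - + 1 → b * b + + 3 ≡ q * (+ 2 * (+ 2 * j + + 1)) →
    ∃ λ l → + 4 * (B * B) - + 2 * B + + 1 ≡ (+ 2 * j + + 1) * (+ 2 * l + + 1)
  odd-cofactor B j q b refl eq with parity q
  -- b² + 3 = 4 (4B² - 2B + 1) is divisible by 4, whereas an odd q would leave a single factor 2 on
  -- the right.
  ... | odd i refl = ⊥-elim (2z≢1 (+ 4 * (B * B) - + 2 * B + + 1 - + 2 * (j * i) - j - i) (halve (lem B j i eq)))
    where
    lem : ∀ B j i → (+ 4 * B - + 1) * (+ 4 * B - + 1) + + 3 ≡ (+ 2 * i + + 1) * (+ 2 * (+ 2 * j + + 1)) →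
      + 2 * (+ 2 * (+ 4 * (B * B) - + 2 * B + + 1 - + 2 * (j * i) - j - i)) ≡ + 2 * + 1
    lem B j i eq = by-hyp (+ 1) eq (solve (B ∷ j ∷ i ∷ []))
  ... | even i refl with parity i
  ...   | even l refl = ⊥-elim (2z≢1 ((+ 2 * j + + 1) * l - + 2 * (B * B) + B) (ℤₚ.*-cancelˡ-≡ (+ 4) _ _ (lem B j l eq)))
    where
    lem : ∀ B j l → (+ 4 * B - + 1) * (+ 4 * B - + 1) + + 3 ≡ + 2 * (+ 2 * l) * (+ 2 * (+ 2 * j + + 1)) →
      + 4 * (+ 2 * ((+ 2 * j + + 1) * l - + 2 * (B * B) + B)) ≡ + 4 * + 1
    lem B j l eq = by-hyp (- (+ 1)) eq (solve (B ∷ j ∷ l ∷ []))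
  ...   | odd l refl = l , ℤₚ.*-cancelˡ-≡ (+ 4) _ _ (lem B j l eq)
    where
    lem : ∀ B j l → (+ 4 * B - + 1) * (+ 4 * B - + 1) + + 3 ≡ + 2 * (+ 2 * l + + 1) * (+ 2 * (+ 2 * j + + 1)) →
      + 4 * (+ 4 * (B * B) - + 2 * B + + 1) ≡ + 4 * ((+ 2 * j + + 1) * (+ 2 * l + + 1))
    lem B j l eq = by-hyp (+ 1) eq (solve (B ∷ j ∷ l ∷ []))

  module Parameters (b₀ m' : ℕ) (1<b₀ : 1 < b₀) (2<m : 2 < suc m')
    (m∣ : suc m' ∣ ((4 ℕ.* b₀ ∸ 1) ^ 2 ℕ.+ 3)) (m%4 : suc m' % 4 ≡ 2) (b<2m : 4 ℕ.* b₀ ∸ 1 < 2 ℕ.* suc m') where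

    m bn j kn : ℕ
    m = suc m'
    bn = 4 ℕ.* b₀ ∸ 1
    j = m ℕ./ 4
    kn = 1 ℕ.+ j ℕ.* 2

    m≡ : m ≡ 2 ℕ.+ j ℕ.* 4
    m≡ = trans (m≡m%n+[m/n]*n m 4) (cong (ℕ._+ j ℕ.* 4) m%4)

    jℤ B K H : ℤ
    jℤ = + j
    B = + b₀
    K = + 2 * jℤ + + 1
    H = K - + 2 * B

    K≡ : K ≡ + kn
    K≡ = trans (lem jℤ) (cong (λ z → + 1 + z) (sym (ℤₚ.pos-* j 2)))
      where lem : ∀ j → + 2 * j + + 1 ≡ + 1 + j * + 2
            lem = solve-∀

    m≡2K : + m ≡ + 2 * K
    m≡2K = trans (cong +_ m≡) (trans (cong (λ z → + 2 + z) (ℤₚ.pos-* j 4)) (lem jℤ))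
      where lem : ∀ j → + 2 + j * + 4 ≡ + 2 * (+ 2 * j + + 1)
            lem = solve-∀

    bn≡ : + bn ≡ + 4 * B - + 1
    bn≡ = lem (+ bn) B (trans (cong +_ (ℕₚ.m∸n+n≡m {4 ℕ.* b₀} {1}
        (ℕₚ.≤-trans (ℕₚ.<⇒≤ 1<b₀) (ℕₚ.m≤n*m b₀ 4)))) (ℤₚ.pos-* 4 b₀))
      where lem : ∀ b B → b + + 1 ≡ + 4 * B → b ≡ + 4 * B - + 1
            lem b B eq = by-hyp (+ 1) eq (solve (b ∷ B ∷ []))

    cofactor : ∃ λ l → + 4 * (B * B) - + 2 * B + + 1 ≡ K * (+ 2 * l + + 1)
    cofactor = odd-cofactor B jℤ (+ q) (+ bn) bn≡ (begin
      + bn * + bn + + 3          ≡⟨ cong (λ z → z + + 3) (ℤₚ.pos-* bn bn) ⟨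
      + (bn ℕ.* bn ℕ.+ 3)        ≡⟨ cong (λ z → + (bn ℕ.* z ℕ.+ 3)) (ℕₚ.*-identityʳ bn) ⟨
      + (bn ^ 2 ℕ.+ 3)           ≡⟨ cong +_ (_∣_.equality m∣) ⟩
      + (q ℕ.* m)                ≡⟨ ℤₚ.pos-* q m ⟩
      + q * + m                  ≡⟨ cong (+ q *_) m≡2K ⟩
      + q * (+ 2 * K)            ∎)
      where
      open ≡-Reasoning
      q = ℕ∣.quotient m∣

    private
      lem-n : ∀ j → 2 ℕ.* (2 ℕ.+ j ℕ.* 4) ≡ 4 ℕ.* (1 ℕ.+ j ℕ.* 2)
      lem-n = ℕSolver.solve-∀
      lem-h : ∀ j B → + 2 * j + + 1 - + 2 * B ≡ + 2 * (j - B) + + 1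
      lem-h = solve-∀
      -- For K = 2j + 1 and H = K - 2B, H² + H + 1 = K (K - 4B + 1) + (4B² - 2B + 1), and the last
      -- summand is K (2l + 1). The total factor is odd because K - 4B + 1 is even.
      lem-hh : ∀ j B l → + 4 * (B * B) - + 2 * B + + 1 ≡ (+ 2 * j + + 1) * (+ 2 * l + + 1) →
        (+ 2 * j + + 1 - + 2 * B) * (+ 2 * j + + 1 - + 2 * B) + (+ 2 * j + + 1 - + 2 * B) + + 1 ≡
        (+ 2 * j + + 1) * (+ 2 * (j - + 2 * B + l + + 1) + + 1)
      lem-hh j B l eq = by-hyp (+ 1) eq (solve (j ∷ B ∷ l ∷ []))
      lem-b : ∀ j B → + 4 * B - + 1 ≡ + 2 * (+ 2 * j + + 1) - + 2 * (+ 2 * j + + 1 - + 2 * B) - + 1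
      lem-b = solve-∀
      lem-c : ∀ j B → + 4 * B - + 1 + + 2 * (+ 2 * j + + 1) + + 1 ≡ + 4 * (+ 2 * j + + 1) - + 2 * (+ 2 * j + + 1 - + 2 * B)
      lem-c = solve-∀
      lem-d : ∀ m K → + 1 + m ≡ + 2 * K → m ≡ + 2 * K - + 1
      lem-d m K eq = by-hyp (+ 1) eq (solve (m ∷ K ∷ []))

    -- The first argument is 2m - 1 in the shape to which 2 * m reduces, so the vertex set is
    -- definitionally the one in the theorem.
    open Nest (m' ℕ.+ (suc m' ℕ.+ 0)) kn bn (bn ℕ.+ m ℕ.+ 1) m' K H (jℤ - B) (jℤ - + 2 * B + proj₁ cofactor + + 1)
      (trans (cong (2 ℕ.*_) m≡) (lem-n j))
      (lower-bound b₀ m j 1<b₀ 2<m m∣ b<2m m≡)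
      K≡
      (lem-h jℤ B)
      (lem-hh jℤ B (proj₁ cofactor) (proj₂ cofactor))
      (trans bn≡ (lem-b jℤ B))
      (trans (cong₂ (λ x y → x + y + + 1) bn≡ m≡2K) (lem-c jℤ B))
      (lem-d (+ m') K m≡2K)
      public

    3∣m⇒3∣k : 3 ∣ m → 3∣k
    3∣m⇒3∣k (ℕ∣.divides q eq) = K - + q , lem K (+ q) (trans (sym m≡2K) (trans (cong +_ eq) (ℤₚ.pos-* q 3)))
      where lem : ∀ k q → + 2 * k ≡ q * + 3 → k ≡ (k - q) * + 3
            lem k q eq = by-hyp (- (+ 1)) eq (solve (k ∷ q ∷ []))

    3∣k⇒3∣m : 3∣k → 3 ∣ m
    3∣k⇒3∣m (t , eq) = ℕ∣.divides ∣ + 2 * t ∣ (trans (cong ∣_∣ (lem (+ m) K t m≡2K eq)) (ℤₚ.abs-* (+ 2 * t) (+ 3)))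
      where lem : ∀ m k t → m ≡ + 2 * k → k ≡ t * + 3 → m ≡ + 2 * t * + 3
            lem m k t refl refl = solve (t ∷ [])

open import Data.Nat using (_+_; _*_)

theorem4p15 : (b₀ m : ℕ) → 1 < b₀ → 2 < m → 2 ∣ m → m ∣ ((4 * b₀ ∸ 1) ^ 2 + 3) →
    m % 4 ≡ 2 → (4 * b₀ ∸ 1) < 2 * m →
    HalfArcTransitive (ΓAdj (4 * b₀ ∸ 1) m) ×
    ((x₀ y₀ : NestV (2 * m)) → ΓAdj (4 * b₀ ∸ 1) m x₀ y₀ →
    (UniversalReachability (ΓAdj (4 * b₀ ∸ 1) m) (Oriented (ΓAdj (4 * b₀ ∸ 1) m) x₀ y₀) ⇔ (¬ 3 ∣ m)) ×
    (3 ∣ m → ThreeAlternets (ΓAdj (4 * b₀ ∸ 1) m) (Oriented (ΓAdj (4 * b₀ ∸ 1) m) x₀ y₀)))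
theorem4p15 b₀ (suc m') 1<b₀ 2<m _ m∣ m%4 b<2m = halfArcTransitive , λ x₀ y₀ adj →
    mk⇔ (λ univ 3∣m → oriented-not-universal adj (3∣m⇒3∣k 3∣m) univ)
        (λ 3∤m → oriented-universal adj (λ d → 3∤m (3∣k⇒3∣m d))) ,
    λ 3∣m → oriented-three-alternets adj (3∣m⇒3∣k 3∣m)
  where open NestGraph.Parameters b₀ m' 1<b₀ 2<m m∣ m%4 b<2m
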